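{- There exists an absolute constant $C > 0$ such that for every integer $H \geq 3$, $$H+1 \leq \nu(H) \leq C H^3.$$
   Context: For a subset $A \subseteq \mathbb{Z}$ and a positive integer $h$, the $h$-fold iterated sumset is $hA:=\{a_1+\cdots+a_h : a_1,\ldots,a_h \in A\}$ (repetitions allowed), and $|X|$ denotes the cardinality of a finite set $X$. For integers $a \le b$, $[a,b]:=\{a,a+1,\ldots,b\}$. For a positive integer $H$, $\nu(H)$ denotes the smallest natural number $N$ such that for each choice of signs $\epsilon_1, \ldots, \epsilon_H \in \{ -,+\}$, there are sets $A,B \subseteq [0,N]$ such that $|hA|-|hB|$ has the same sign as $\epsilon_h$ for each $1 \leq h \leq H$ (that is, $|hA|-|hB|>0$ if $\epsilon_h = +$ and $|hA|-|hB|<0$ if $\epsilon_h=-$). Such an $N$ exists for every $H$. -}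

module Defs where

open import Data.Fin using (Fin; toℕ)
open import Data.Integer as ℤ using (ℤ; +_; 0ℤ; _⊖_)
open import Data.Integer.Properties using (_≟_)
open import Data.List using (List; []; _∷_; map; length; deduplicate; cartesianProductWith)
open import Data.List.Relation.Unary.All using (All)
open import Data.Nat using (ℕ; zero; suc; _≤_)
open import Data.Product using (_×_; ∃-syntax)
open import Data.Sign using (Sign)
open import Data.Vec as Vec using (Vec; lookup)

-- A finite set of integers is given by any list of its elements; order and
-- multiplicity are irrelevant, since sizes are counted after deduplication.
FiniteSet : Set
FiniteSet = List ℤ

∣_∣ : FiniteSet → ℕ
∣ X ∣ = length (deduplicate _≟_ X)

_⊆[_,_] : FiniteSet → ℤ → ℤ → Set
X ⊆[ a , b ] = All (λ x → (a ℤ.≤ x) × (x ℤ.≤ b)) X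

tuples : (h : ℕ) → FiniteSet → List (Vec ℤ h)
tuples zero    A = Vec.[] ∷ []
tuples (suc h) A = cartesianProductWith Vec._∷_ A (tuples h A)

-- hA = { a₁ + ⋯ + aₕ : a₁, …, aₕ ∈ A }
sumset : ℕ → FiniteSet → FiniteSet
sumset h A = map (Vec.foldr′ ℤ._+_ 0ℤ) (tuples h A)

HasSign : Sign → ℤ → Set
HasSign Sign.+ z = 0ℤ ℤ.< z
HasSign Sign.- z = z ℤ.< 0ℤ

-- m ⊖ n is the integer m - n.  The index i : Fin H stands for h = toℕ i + 1,
-- so that h runs over 1, …, H.
AllSignsRealizedIn[0,_] : ℕ → ℕ → Set
AllSignsRealizedIn[0, N ] H =
  (ε : Vec Sign H) →
  ∃[ A ] ∃[ B ]
    (A ⊆[ 0ℤ , + N ]) × (B ⊆[ 0ℤ , + N ]) ×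
    ((i : Fin H) → let h = suc (toℕ i) in
      HasSign (lookup ε i) (∣ sumset h A ∣ ⊖ ∣ sumset h B ∣))

-- ν H is the least N with the above property.  It is given by its graph, since
-- defining it as a function would require first proving that such an N exists.
ν[_]≡_ : ℕ → ℕ → Set
ν[ H ]≡ N =
  AllSignsRealizedIn[0, N ] H ×
  ((M : ℕ) → AllSignsRealizedIn[0, M ] H → N ≤ M)

{-# OPTIONS --safe #-}

-- Lower bound.  Let A ⊆ [α, α + b] contain both end points.  For h ≥ b - 2 the sizes
-- of hA, (h+1)A and (h+2)A are in arithmetic progression, so two sets in [0, H] cannot
-- realize the signs +, -, + at H - 2, H - 1, H.  By inclusion-exclusion for the translates
-- α + (h+1)A and α + b + (h+1)A this follows from two facts (with α = 0).
--  * (h+2)A is the union of the two translates: among b ≤ h + 2 summands there is a block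
--    with sum q b, and it can be replaced by copies of b and 0.
--  * The two translates meet in b + hA.  If n ∉ hA while n and n + b are in (h+1)A, take
--    representations T of n + b and X of an n - m b, m ≥ 0, and write T = C ∪ S, X = C ∪ R.
--    The sequence C, R, -S has a zero-sum block mod b even without its last term, and
--    exchanging along it shortens T, or R for the same T.
--
-- Upper bound.  Both sets contain 0, 1 and a long interval [K, N] absorbing all sums ≥ K.
-- In addition, the block of k consists of a start s, s + 2k, and a middle point s + k or
-- s + k + 1.  In hA the block becomes three intervals of length h: disjoint for h < k, with
-- union [s, s + 2k + h) for h > k, and for h = k missing one point exactly when the middle
-- point is s + k + 1.  So the block of k only influences the comparison of kA and kB.

module Submission where

open import Algebra.Bundles using (AbelianGroup)
import Algebra.Properties.Group as GroupProperties
import Algebra.Solver.CommutativeMonoid as CMSolver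
open import Data.Bool as Bool using (true)
open import Data.Empty using (⊥)
open import Data.Fin as Fin using (Fin; toℕ; fromℕ<)
import Data.Fin.Properties as Fin
open import Data.Fin.Subset using (Subset)
open import Data.Fin.Subset.Properties using (anySubset?)
open import Data.Integer as ℤ using (ℤ; +_; 0ℤ; _⊖_)
import Data.Integer.Properties as ℤ
open import Data.Integer.Tactic.RingSolver using () renaming (solve-∀ to ℤ-solve-∀)
open import Data.List as List using (List; []; _∷_; _++_; length; map; replicate; take; drop; filter; allFin; upTo; deduplicate)
open import Data.List.Extrema ℤ.≤-totalOrder using (min; max; min≤⊤; min≤xs; ⊥≤max; xs≤max; argmin-sel; argmax-sel)
open import Data.List.Membership.DecPropositional ℤ._≟_ using (_∈?_)
open import Data.List.Membership.Propositional using (_∈_; _∉_)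
open import Data.List.Membership.Propositional.Properties
open import Data.List.Membership.Setoid.Properties using () renaming (index-injective to index-injectiveₛ)
open import Data.List.Properties using (length-++; length-map; length-drop; take++drop≡id; length-replicate; ++-identityʳ; ∷-injective)
open import Data.List.Relation.Binary.Permutation.Propositional using (_↭_; ↭-refl)
open import Data.List.Relation.Binary.Permutation.Propositional.Properties using (All-resp-↭; ↭-length; ++-commutativeMonoid)
open import Data.List.Relation.Binary.Subset.Propositional using (_⊆_)
open import Data.List.Relation.Unary.All as All using (All; []; _∷_)
open import Data.List.Relation.Unary.All.Properties using (++⁺; ++⁻ˡ; ++⁻ʳ; replicate⁺)
open import Data.List.Relation.Unary.AllPairs using ([]; _∷_)
open import Data.List.Relation.Unary.Any using (here; there; index)
open import Data.List.Relation.Unary.Unique.DecPropositional.Properties ℤ._≟_ using (deduplicate-!)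
open import Data.List.Relation.Unary.Unique.Propositional using (Unique)
import Data.List.Relation.Unary.Unique.Propositional.Properties as Unique
open import Data.Nat
import Data.List.Membership.DecPropositional _≟_ as ℕ-List
open import Data.Nat.Divisibility using (_∣_; divides; ∣m+n∣m⇒∣n; ∣m∣n⇒∣m+n; ∣-reflexive; _∣0)
open import Data.Nat.DivMod using (_%_; _/_; m%n<n; m≡m%n+[m/n]*n; [m+kn]%n≡m%n; m<n⇒m%n≡m)
open import Data.Nat.ListAction using (sum)
open import Data.Nat.ListAction.Properties using (sum-++; sum-↭)
open import Data.Nat.Properties
open import Data.Nat.Tactic.RingSolver using (solve-∀)
open import Data.Product using (∃-syntax; _×_; _,_; proj₁; proj₂)
open import Data.Sign using (Sign; opposite)
open import Data.Sum using (_⊎_; inj₁; inj₂; [_,_]′)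
open import Data.Vec as Vec using (Vec; lookup; tabulate)
open import Data.Vec.Properties using (lookup∘tabulate)
open import Defs
open import Function using (_∘_; case_of_; id)
open import Relation.Binary.Definitions using (tri<; tri≈; tri>)
open import Relation.Binary.PropositionalEquality
open import Relation.Nullary using (¬_; Dec; yes; no; contradiction; does)
open import Relation.Nullary.Decidable using (map′; dec-true; decidable-stable; ¬?; _×-dec_; _⊎-dec_)
open import Relation.Unary using (Decidable)

-- Zero-sum blocks

take-+ : ∀ {X : Set} i d (w : List X) → take (i + d) w ≡ take i w ++ take d (drop i w)
take-+ zero    d w       = refl
take-+ (suc i) zero []   = refl
take-+ (suc i) (suc d) [] = refl
take-+ (suc i) d (x ∷ w) = cong (x ∷_) (take-+ i d w)

%-cong⇒∣ : ∀ m k b .{{_ : NonZero b}} → m % b ≡ (m + k) % b → b ∣ k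
%-cong⇒∣ m k b eq =
  ∣m+n∣m⇒∣n (divides ((m + k) / b) (+-cancelˡ-≡ (m % b) _ _ main)) (divides (m / b) refl)
  where
  open ≡-Reasoning
  main : m % b + (m / b * b + k) ≡ m % b + (m + k) / b * b
  main = begin
    m % b + (m / b * b + k)           ≡⟨ sym (+-assoc (m % b) _ k) ⟩
    m % b + m / b * b + k             ≡⟨ cong (_+ k) (sym (m≡m%n+[m/n]*n m b)) ⟩
    m + k                             ≡⟨ m≡m%n+[m/n]*n (m + k) b ⟩
    (m + k) % b + (m + k) / b * b     ≡⟨ cong (_+ (m + k) / b * b) (sym eq) ⟩
    m % b + (m + k) / b * b           ∎

-- Pigeonhole on the residues of the prefix sums: counting the empty prefix there are more than `b`
-- of them.
zero-sum-block : ∀ b .{{_ : NonZero b}} (w : List ℕ) → b ≤ length w →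
  ∃[ u ] ∃[ z ] ∃[ v ] (w ≡ u ++ (z ++ v)) × (0 < length z) × (b ∣ sum z)
zero-sum-block b w b≤w
  with i , j , i<j , eq ← Fin.pigeonhole (s≤s b≤w) (λ i → Fin.fromℕ< (m%n<n (sum (take (toℕ i) w)) b))
  with d , toℕj≡ ← m≤n⇒∃[o]m+o≡n i<j
  = take (toℕ i) w , take (suc d) w′ , drop (suc d) w′ ,
    sym (trans (cong (take (toℕ i) w ++_) (take++drop≡id (suc d) w′)) (take++drop≡id (toℕ i) w)) ,
    len ,
    %-cong⇒∣ (sum (take (toℕ i) w)) _ b (trans (Fin.fromℕ<-injective _ _ _ _ eq) (cong (_% b) sum-take-j))
  where
  w′ = drop (toℕ i) w
  j≡ : toℕ j ≡ toℕ i + suc d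
  j≡ = trans (sym toℕj≡) (sym (+-suc (toℕ i) d))
  sum-take-j : sum (take (toℕ j) w) ≡ sum (take (toℕ i) w) + sum (take (suc d) w′)
  sum-take-j rewrite j≡ | take-+ (toℕ i) (suc d) w = sum-++ (take (toℕ i) w) _
  0<w′ : 0 < length w′
  0<w′ rewrite length-drop (toℕ i) w = m<n⇒0<n∸m (<-≤-trans i<j (≤-pred (Fin.toℕ<n j)))
  len : 0 < length (take (suc d) w′)
  len with w′ | 0<w′
  ... | _ ∷ _ | _ = z<s

-- Serves to find which of the pieces C, R, -S a zero-sum block meets.
++-split : ∀ {X : Set} (u x : List X) {y v} → u ++ v ≡ x ++ y →
  (∃[ k ] (x ≡ u ++ k) × (v ≡ k ++ y)) ⊎ (∃[ k ] (u ≡ x ++ k) × (y ≡ k ++ v))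
++-split []      x       eq = inj₁ (x , refl , eq)
++-split (a ∷ u) []      eq = inj₂ (a ∷ u , refl , sym eq)
++-split (a ∷ u) (c ∷ x) eq with refl , eq′ ← ∷-injective eq with ++-split u x eq′
... | inj₁ (k , p , q) = inj₁ (k , cong (a ∷_) p , q)
... | inj₂ (k , p , q) = inj₂ (k , cong (a ∷_) p , q)

map-≡-++ : ∀ {X Y : Set} (f : X → Y) xs ys {zs} → map f xs ≡ ys ++ zs →
  ∃[ us ] ∃[ vs ] (xs ≡ us ++ vs) × (map f us ≡ ys) × (map f vs ≡ zs)
map-≡-++ f xs       []       eq = [] , xs , refl , refl , eq
map-≡-++ f (x ∷ xs) (y ∷ ys) eq with refl , eq′ ← ∷-injective eq
  with us , vs , p , q , r ← map-≡-++ f xs ys eq′ = x ∷ us , vs , cong (x ∷_) p , cong (f x ∷_) q , r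

sum-replicate : ∀ k a → sum (replicate k a) ≡ k * a
sum-replicate zero    a = refl
sum-replicate (suc k) a = cong (_+_ a) (sum-replicate k a)

sum≤length*bound : ∀ {b l} → All (_≤ b) l → sum l ≤ length l * b
sum≤length*bound []       = z≤n
sum≤length*bound (a ∷ as) = +-mono-≤ a (sum≤length*bound as)

-- Modulo `b` the number `b ∸ a` is the negative of `a`, so the sequence containing -S can stay in
-- `ℕ`.
sum-complement : ∀ {b l} → All (_≤ b) l → sum (map (b ∸_) l) + sum l ≡ length l * b
sum-complement []                 = refl
sum-complement {b} {a ∷ l} (a≤b ∷ as) = begin
  (b ∸ a + sum (map (b ∸_) l)) + (a + sum l)   ≡⟨ interchange (b ∸ a) (sum (map (b ∸_) l)) a (sum l) ⟩
  (b ∸ a + a) + (sum (map (b ∸_) l) + sum l)   ≡⟨ cong₂ _+_ (m∸n+n≡m a≤b) (sum-complement as) ⟩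
  b + length l * b                             ∎
  where
  open ≡-Reasoning
  interchange : ∀ x y z w → (x + y) + (z + w) ≡ (x + z) + (y + w)
  interchange = solve-∀

-- Membership in an `h`-fold sumset, with the list of terms kept at hand so that it can be permuted
-- and cut.
Sums : (ℕ → Set) → ℕ → ℕ → Set
Sums Q h x = ∃[ l ] All Q l × (length l ≡ h) × (sum l ≡ x)

-- Sumsets near the diameter

open module ↭-Solver = CMSolver (++-commutativeMonoid {A = ℕ}) using (_⊕_; _⊜_) renaming (solve to ↭-solve)

-- Reduces X ≡ Y, given hypotheses summed up to P ≡ Q, to a semiring identity.
+-combine : ∀ {P Q : ℕ} X Y → P ≡ Q → X + Q ≡ Y + P → X ≡ Y
+-combine {Q = Q} X Y eq ring = +-cancelʳ-≡ Q X Y (trans ring (cong (_+_ Y) eq))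

module Exchange
  (Q : ℕ → Set) (b : ℕ) .{{_ : NonZero b}}
  (Q0 : Q 0) (Qb : Q b) (Q≤b : ∀ {a} → Q a → a ≤ b)
  (p n : ℕ) (b≤ : b ≤ 2 + p)
  (n∉pQ : ¬ Sums Q p n)
  (R₀ : List ℕ) (allR₀ : All Q R₀) (sumR₀ : sum R₀ ≡ n)
  where

  -- The T of the header. The bound `t` is the measure of the outer induction.
  record Top (t : ℕ) (l : List ℕ) : Set where
    constructor top
    field
      all   : All Q l
      total : sum l ≡ n + b
      short : length l ≤ t

  -- The X of the header, with `deficit` as its m. Its length is unbounded, so zero-sum blocks may
  -- be removed freely at the cost of a larger deficit.
  record Bottom (l : List ℕ) : Set where
    constructor bottom
    field
      all     : All Q l
      deficit : ℕ
      total   : sum l + deficit * b ≡ n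

  Top-resp : ∀ {t l l′} → l ↭ l′ → Top t l → Top t l′
  Top-resp σ (top al eq len) =
    top (All-resp-↭ σ al) (trans (sym (sum-↭ σ)) eq) (subst (_≤ _) (↭-length σ) len)

  Bottom-resp : ∀ {l l′} → l ↭ l′ → Bottom l → Bottom l′
  Bottom-resp σ (bottom al m eq) =
    bottom (All-resp-↭ σ al) m (trans (cong (_+ m * b) (sym (sum-↭ σ))) eq)

  -- A shorter list, padded by `deficit` copies of `b` and by zeros, would put n into the `p`-fold
  -- sumset.
  bottom-long : ∀ {l} (x : Bottom l) → p < length l + Bottom.deficit x
  bottom-long {l} (bottom al m eq) = ≰⇒> λ len →
    let k = p ∸ (length l + m) in
    n∉pQ (l ++ replicate m b ++ replicate k 0 ,
      ++⁺ al (++⁺ (replicate⁺ m Qb) (replicate⁺ k Q0)) ,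
      (begin
        length (l ++ replicate m b ++ replicate k 0)
          ≡⟨ length-++ l ⟩
        length l + length (replicate m b ++ replicate k 0)
          ≡⟨ cong (_+_ (length l)) (length-++ (replicate m b)) ⟩
        length l + (length (replicate m b) + length (replicate k 0))
          ≡⟨ cong₂ (λ x y → length l + (x + y)) (length-replicate m) (length-replicate k) ⟩
        length l + (m + k)
          ≡⟨ sym (+-assoc (length l) m k) ⟩
        length l + m + k
          ≡⟨ m+[n∸m]≡n len ⟩
        p ∎) ,
      (begin
        sum (l ++ replicate m b ++ replicate k 0)
          ≡⟨ sum-++ l _ ⟩
        sum l + sum (replicate m b ++ replicate k 0)
          ≡⟨ cong (_+_ (sum l)) (sum-++ (replicate m b) _) ⟩
        sum l + (sum (replicate m b) + sum (replicate k 0))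
          ≡⟨ cong₂ (λ x y → sum l + (x + y)) (sum-replicate m b) (trans (sum-replicate k 0) (*-zeroʳ k)) ⟩
        sum l + (m * b + 0)
          ≡⟨ cong (_+_ (sum l)) (+-identityʳ (m * b)) ⟩
        sum l + m * b
          ≡⟨ eq ⟩
        n ∎))
    where open ≡-Reasoning

  Bottom-remove : ∀ z {l} → b ∣ sum z → Bottom (z ++ l) → Bottom l
  Bottom-remove z {l} (divides q sz) (bottom al m eq) =
    bottom (++⁻ʳ z al) (q + m)
      (+-combine _ _ (cong₂ _+_ eq (cong₂ _+_ (sym (sum-++ z l)) (sym sz))) (ring (sum z) (sum l) (sum (z ++ l)) q m n b))
    where
    ring : ∀ z l zl q m n b → l + (q + m) * b + (n + (zl + z)) ≡ n + ((zl + m * b) + ((z + l) + q * b))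
    ring = solve-∀

  -- Outer induction hypothesis: T contains no nonempty zero-sum part. Lists are taken up to
  -- permutation, so such a part may stand in front.
  Reduce : ℕ → Set
  Reduce t = ∀ z l → 0 < length z → b ∣ sum z → Top t (z ++ l) → ⊥

  -- Inner induction hypothesis, on the length of the part `R` that X does not share with T.
  Descend : ℕ → ℕ → Set
  Descend t k = ∀ C S R → Top t (C ++ S) → Bottom (C ++ R) → length R < k → ⊥

  -- The representations of the header are T = C ∪ {a} ∪ S′ and X = C ∪ R; a is the term of
  -- -S left out of the sequence.
  module Step {t} (reduce : Reduce t) (C S′ R : List ℕ) (a : ℕ)
    (descend : Descend t (length R))
    (T : Top t (C ++ (a ∷ S′))) (X : Bottom (C ++ R)) where

    m : ℕ
    m = Bottom.deficit X

    complement-∣ : ∀ s → All Q s → b ∣ sum (map (b ∸_) s) → b ∣ sum s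
    complement-∣ s qs b∣ = ∣m+n∣m⇒∣n (divides (length s) (sum-complement (All.map Q≤b qs))) b∣

    allS′ : All Q S′
    allS′ = All.tail (++⁻ʳ C (Top.all T))

    in-C : ∀ u z k → C ≡ u ++ (z ++ k) → 0 < length z → b ∣ sum z → ⊥
    in-C u z k refl pos b∣z = reduce z (u ++ (k ++ (a ∷ S′))) pos b∣z
      (Top-resp (↭-solve 4 (λ u z k s → (u ⊕ (z ⊕ k)) ⊕ s ⊜ z ⊕ (u ⊕ (k ⊕ s))) ↭-refl u z k (a ∷ S′)) T)

    in-CR : ∀ u k z r → C ≡ u ++ k → R ≡ z ++ r → 0 < length (k ++ z) → b ∣ sum (k ++ z) → ⊥
    -- An empty part of `R` would not make `R` shorter, but then the block lies in `C`.
    in-CR u k [] r eq refl pos b∣ =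
      in-C u (k ++ []) [] (trans eq (append-[] u k)) pos b∣
      where
      append-[] : ∀ u k → u ++ k ≡ u ++ ((k ++ []) ++ [])
      append-[] u k = cong (u ++_) (sym (trans (++-identityʳ _) (++-identityʳ k)))
    in-CR u k z@(_ ∷ z′) r refl refl pos b∣ = descend u (k ++ (a ∷ S′)) r
      (Top-resp (↭-solve 3 (λ u k s → (u ⊕ k) ⊕ s ⊜ u ⊕ (k ⊕ s)) ↭-refl u k (a ∷ S′)) T)
      (Bottom-remove (k ++ z) b∣
        (Bottom-resp (↭-solve 4 (λ u k z r → (u ⊕ k) ⊕ (z ⊕ r) ⊜ (k ⊕ z) ⊕ (u ⊕ r)) ↭-refl u k z r) X))
      (s≤s (≤-trans (m≤n+m (length r) (length z′)) (≤-reflexive (sym (length-++ z′)))))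

    in-R : ∀ u z r → R ≡ u ++ (z ++ r) → 0 < length z → b ∣ sum z → ⊥
    in-R u z r refl pos b∣ = descend C (a ∷ S′) (u ++ r) T
      (Bottom-remove z b∣
        (Bottom-resp (↭-solve 4 (λ c u z r → c ⊕ (u ⊕ (z ⊕ r)) ⊜ z ⊕ (c ⊕ (u ⊕ r))) ↭-refl C u z r) X))
      (subst (length (u ++ r) <_)
        (trans (sym (length-++ z)) (↭-length (↭-solve 3 (λ u z r → z ⊕ (u ⊕ r) ⊜ u ⊕ (z ⊕ r)) ↭-refl u z r)))
        (m<n+m (length (u ++ r)) {n = length z} pos))

    in-S : ∀ u z s → S′ ≡ u ++ (z ++ s) → 0 < length z → b ∣ sum z → ⊥
    in-S u z s refl pos b∣ = reduce z (C ++ ((a ∷ u) ++ s)) pos b∣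
      (Top-resp (↭-solve 4 (λ c u z s → c ⊕ (u ⊕ (z ⊕ s)) ⊜ z ⊕ (c ⊕ (u ⊕ s))) ↭-refl C (a ∷ u) z s) T)

    -- A block containing all of R is, modulo ΣT - ΣX ≡ 0, a zero-sum part of T.
    across-R : ∀ u k s₁ s₂ → C ≡ u ++ k → S′ ≡ s₁ ++ s₂ →
      b ∣ sum (k ++ (R ++ map (b ∸_) s₁)) → ⊥
    across-R u k s₁ s₂ refl refl (divides q eq) = reduce (k ++ (a ∷ s₂)) (u ++ s₁) pos
      -- Since ΣT - ΣX = (m + 1) b, the part has sum (q + m + 1) b minus `length s₁` copies of `b`.
      (∣m+n∣m⇒∣n (divides (q + suc m) main) (divides (length s₁) refl))
      (Top-resp (↭-solve 4 (λ u k s₁ s₂ → (u ⊕ k) ⊕ (s₁ ⊕ s₂) ⊜ (k ⊕ s₂) ⊕ (u ⊕ s₁)) ↭-refl u k s₁ (a ∷ s₂))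
        (Top-resp (↭-solve 4 (λ c a s₁ s₂ → c ⊕ (a ⊕ (s₁ ⊕ s₂)) ⊜ c ⊕ (s₁ ⊕ (a ⊕ s₂))) ↭-refl (u ++ k) (a ∷ []) s₁ s₂) T))
      where
      pos : 0 < length (k ++ (a ∷ s₂))
      pos rewrite length-++ k {a ∷ s₂} | +-suc (length k) (length s₂) = z<s
      sumT : (sum u + sum k) + (a + (sum s₁ + sum s₂)) ≡ n + b
      sumT = trans (sym (trans (sum-++ (u ++ k) _) (cong₂ (λ x y → x + (a + y)) (sum-++ u k) (sum-++ s₁ s₂)))) (Top.total T)
      sumX : ((sum u + sum k) + sum R) + m * b ≡ n
      sumX = trans (cong (_+ m * b) (sym (trans (sum-++ (u ++ k) R) (cong (_+ sum R) (sum-++ u k))))) (Bottom.total X)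
      sumD : sum k + (sum R + sum (map (b ∸_) s₁)) ≡ q * b
      sumD = trans (sym (trans (sum-++ k _) (cong (_+_ (sum k)) (sum-++ R _)))) eq
      ring : ∀ u k a s₁ s₂ n b r m q d L →
        L * b + (k + (a + s₂)) + (((n + b) + (((u + k) + r) + m * b)) + (q * b + (d + s₁)))
        ≡ (q + suc m) * b + ((((u + k) + (a + (s₁ + s₂))) + n) + ((k + (r + d)) + L * b))
      ring = solve-∀
      main : length s₁ * b + sum (k ++ (a ∷ s₂)) ≡ (q + suc m) * b
      main = trans (cong (_+_ (length s₁ * b)) (sum-++ k (a ∷ s₂)))
        (+-combine _ _ (cong₂ _+_ (cong₂ _+_ sumT (sym sumX)) (cong₂ _+_ sumD (sym (sum-complement (All.map Q≤b (++⁻ˡ s₁ allS′))))))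
          (ring (sum u) (sum k) a (sum s₁) (sum s₂) n b (sum R) m q (sum (map (b ∸_) s₁)) (length s₁)))

    -- (C ∪ S \ S₁ ∪ R₂) and (C ∪ S₁ ∪ R₁) have total sum ΣT + ΣX, hence one of them has sum ≤ n.
    exchange : ∀ r₁ r₂ s₁ s₂ → R ≡ r₁ ++ r₂ → S′ ≡ s₁ ++ s₂ →
      0 < length (r₂ ++ map (b ∸_) s₁) → b ∣ sum (r₂ ++ map (b ∸_) s₁) → ⊥
    exchange r₁ r₂ s₁ s₂ refl refl pos b∣@(divides q eq) = case <-≤-connex q (length s₁) of λ where
        (inj₁ q<L) → exchange-suffix r₁ (m≤n⇒∃[o]m+o≡n q<L) refl
        (inj₂ L≤q) → exchange-prefix r₂ (m≤n⇒∃[o]m+o≡n L≤q) refl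
      where
      d = sum (map (b ∸_) s₁)
      allS : All Q (s₁ ++ (a ∷ s₂))
      allS = All-resp-↭ (↭-solve 3 (λ a s₁ s₂ → a ⊕ (s₁ ⊕ s₂) ⊜ s₁ ⊕ (a ⊕ s₂)) ↭-refl (a ∷ []) s₁ s₂) (++⁻ʳ C (Top.all T))
      allC = ++⁻ˡ C (Top.all T)
      allR = ++⁻ʳ C (Bottom.all X)
      sumT : sum C + (a + (sum s₁ + sum s₂)) ≡ n + b
      sumT = trans (sym (trans (sum-++ C _) (cong (λ x → sum C + (a + x)) (sum-++ s₁ s₂)))) (Top.total T)
      sumX : (sum C + (sum r₁ + sum r₂)) + m * b ≡ n
      sumX = trans (cong (_+ m * b) (sym (trans (sum-++ C _) (cong (_+_ (sum C)) (sum-++ r₁ r₂))))) (Bottom.total X)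
      sumD : sum r₂ + d ≡ q * b
      sumD = trans (sym (sum-++ r₂ _)) eq
      sumS : d + sum s₁ ≡ length s₁ * b
      sumS = sum-complement (All.map Q≤b (++⁻ˡ s₁ allS′))

      sum-suffix : ∀ {e} → suc q + e ≡ length s₁ → (sum C + (a + sum s₂)) + sum r₂ + e * b ≡ n
      sum-suffix {e} q+e = +-combine _ _ (cong₂ _+_ sumT (cong₂ _+_ sumD (trans (cong (_* b) q+e) (sym sumS))))
        (ring (sum C) a (sum s₁) (sum s₂) (sum r₂) d n b q e)
        where
        ring : ∀ c a s₁ s₂ r₂ d n b q e → (c + (a + s₂)) + r₂ + e * b + ((n + b) + ((q * b + (d + s₁))))
               ≡ n + ((c + (a + (s₁ + s₂))) + ((r₂ + d) + (suc q + e) * b))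
        ring = solve-∀

      -- C ∪ {a} ∪ S₂ becomes the common part and `r₂` replaces `R`; this is progress if `r₁` is
      -- nonempty. The equation for `r` allows a case split on `r₁`.
      exchange-suffix : ∀ r → ∃[ e ] suc q + e ≡ length s₁ → r ≡ r₁ → ⊥
      -- If R₁ is empty, both X and its replacement contain C ∪ R. Their sums agree modulo `b`, so a
      -- ∪ S₂ is a zero-sum part of T, nonempty because of `a`.
      exchange-suffix [] (e , q+e) refl = reduce (a ∷ s₂) (C ++ s₁) z<s
        (∣m+n∣m⇒∣n (divides m (+-combine _ _ (cong₂ _+_ (sum-suffix q+e) (sym sumX))
          (ring (sum C) (a + sum s₂) (sum r₂) n b e m)))
          (divides e refl))
        (Top-resp (↭-solve 4 (λ c a s₁ s₂ → c ⊕ (a ⊕ (s₁ ⊕ s₂)) ⊜ (a ⊕ s₂) ⊕ (c ⊕ s₁)) ↭-refl C (a ∷ []) s₁ s₂) T)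
        where
        ring : ∀ c a₂ r n b e m → e * b + a₂ + (n + ((c + r) + m * b)) ≡ m * b + ((c + a₂) + r + e * b + n)
        ring = solve-∀
      exchange-suffix (x ∷ r) (e , q+e) refl = descend (C ++ (a ∷ s₂)) s₁ r₂
        (Top-resp (↭-solve 4 (λ c a s₁ s₂ → c ⊕ (a ⊕ (s₁ ⊕ s₂)) ⊜ (c ⊕ (a ⊕ s₂)) ⊕ s₁) ↭-refl C (a ∷ []) s₁ s₂) T)
        (bottom (++⁺ (++⁺ allC (++⁻ʳ s₁ allS)) (++⁻ʳ r₁ allR)) e
          (trans (cong (_+ e * b) (trans (sum-++ (C ++ (a ∷ s₂)) r₂) (cong (_+ sum r₂) (sum-++ C (a ∷ s₂))))) (sum-suffix q+e)))
        (s≤s (≤-trans (m≤n+m (length r₂) (length r)) (≤-reflexive (sym (length-++ r)))))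

      -- C ∪ S₁ becomes the common part and `r₁` replaces `R`; this is progress if `r₂` is nonempty.
      exchange-prefix : ∀ r → ∃[ e ] length s₁ + e ≡ q → r ≡ r₂ → ⊥
      -- If R₂ is empty, the block consists of negatives of terms of S only.
      exchange-prefix [] _ refl = in-S [] s₁ s₂ refl (subst (0 <_) (length-map (b ∸_) s₁) pos)
        (complement-∣ s₁ (++⁻ˡ s₁ allS) b∣)
      exchange-prefix (x ∷ r) (e , L+e) refl = descend (C ++ s₁) (a ∷ s₂) r₁
          (Top-resp (↭-solve 4 (λ c a s₁ s₂ → c ⊕ (a ⊕ (s₁ ⊕ s₂)) ⊜ (c ⊕ s₁) ⊕ (a ⊕ s₂)) ↭-refl C (a ∷ []) s₁ s₂) T)
          (bottom (++⁺ (++⁺ allC (++⁻ˡ s₁ allS)) (++⁻ˡ r₁ allR)) (m + e)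
            (trans (cong (_+ (m + e) * b) (trans (sum-++ (C ++ s₁) r₁) (cong (_+ sum r₁) (sum-++ C s₁)))) sumE))
          (subst (length r₁ <_) (sym (length-++ r₁)) (m<m+n (length r₁) z<s))
        where
        sumE : (sum C + sum s₁) + sum r₁ + (m + e) * b ≡ n
        sumE = +-combine _ _ (cong₂ _+_ sumX (cong₂ _+_ (trans (cong (_* b) L+e) (sym sumD)) sumS))
          (ring (sum C) (sum s₁) (sum r₁) (sum r₂) d n b e m (length s₁))
          where
          ring : ∀ c s₁ r₁ r₂ d n b e m L → (c + s₁) + r₁ + (m + e) * b + (n + ((r₂ + d) + L * b))
               ≡ n + (((c + (r₁ + r₂)) + m * b) + ((L + e) * b + (d + s₁)))
          ring = solve-∀

    -- The block is an interval of the sequence C, R, -S′. Its first and last pieces leave six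
    -- cases.
    locate : ∀ u z v → u ++ (z ++ v) ≡ C ++ (R ++ map (b ∸_) S′) → 0 < length z → b ∣ sum z → ⊥
    locate u z v eq pos b∣ with ++-split u C eq
    ... | inj₁ (k , C≡ , zv≡) with ++-split z k zv≡
    ...   | inj₁ (k′ , refl , _) = in-C u z k′ C≡ pos b∣
    ...   | inj₂ (z′ , refl , RS≡) with ++-split z′ R (sym RS≡)
    ...     | inj₁ (r , R≡ , _) = in-CR u k z′ r C≡ R≡ pos b∣
    ...     | inj₂ (k′ , refl , S≡) with s₁ , s₂ , S′≡ , refl , _ ← map-≡-++ (b ∸_) S′ k′ S≡ =
      across-R u k s₁ s₂ C≡ S′≡ b∣
    locate u z v eq pos b∣ | inj₂ (k , u≡ , RS≡) with ++-split k R (sym RS≡)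
    ... | inj₁ (k′ , R≡ , zv≡) with ++-split z k′ zv≡
    ...   | inj₁ (k″ , refl , _) = in-R k z k″ R≡ pos b∣
    ...   | inj₂ (z′ , refl , S≡) with s₁ , s₂ , S′≡ , refl , _ ← map-≡-++ (b ∸_) S′ z′ S≡ =
      exchange k k′ s₁ s₂ R≡ S′≡ pos b∣
    locate u z v eq pos b∣ | inj₂ (k , u≡ , RS≡) | inj₂ (k′ , _ , S≡)
      with s₁ , s₂ , S′≡ , _ , zv≡ ← map-≡-++ (b ∸_) S′ k′ S≡
      with s₃ , s₄ , refl , refl , _ ← map-≡-++ (b ∸_) s₂ z zv≡ =
      in-S s₁ s₃ s₄ S′≡ (subst (0 <_) (length-map (b ∸_) s₃) pos)
        (complement-∣ s₃ (++⁻ˡ s₃ (++⁻ʳ s₁ (subst (All Q) S′≡ allS′))) b∣)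

    -- `C ++ R` has at least p + 1 - m terms and S′ at least m + 1, which makes p + 2 ≥ b even
    -- though `a` is left out.
    enough : suc m ≤ length S′ → b ≤ length (C ++ (R ++ map (b ∸_) S′))
    enough long = begin
      b                                        ≤⟨ b≤ ⟩
      suc (suc p)                              ≤⟨ s≤s (bottom-long X) ⟩
      suc (length (C ++ R) + m)                ≡⟨ +-suc (length (C ++ R)) m ⟨
      length (C ++ R) + suc m                  ≤⟨ +-monoʳ-≤ (length (C ++ R)) long ⟩
      length (C ++ R) + length S′              ≡⟨ cong₂ _+_ (length-++ C) (sym (length-map (b ∸_) S′)) ⟩
      length C + length R + length (map (b ∸_) S′) ≡⟨ +-assoc (length C) _ _ ⟩
      length C + (length R + length (map (b ∸_) S′)) ≡⟨ cong (_+_ (length C)) (length-++ R) ⟨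
      length C + length (R ++ map (b ∸_) S′)   ≡⟨ length-++ C ⟨
      length (C ++ (R ++ map (b ∸_) S′))       ∎
      where open ≤-Reasoning

    -- Comparing T with X gives a + ΣS′ = ΣR + (m + 1) b, while ΣS′ ≤ m b. Hence a = b, and `a`
    -- alone is a zero-sum block of T.
    few : length S′ ≤ m → ⊥
    few short =
      reduce (a ∷ []) (C ++ S′) z<s (∣m∣n⇒∣m+n (∣-reflexive (≤-antisym b≤a a≤b)) (b ∣0))
        (Top-resp (↭-solve 3 (λ c a s → c ⊕ (a ⊕ s) ⊜ a ⊕ (c ⊕ s)) ↭-refl C (a ∷ []) S′) T)
      where
      a≤b : a ≤ b
      a≤b = Q≤b (All.head (++⁻ʳ C (Top.all T)))
      difference : a + sum S′ ≡ sum R + suc m * b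
      difference = +-combine _ _
        (cong₂ _+_ (trans (sym (sum-++ C (a ∷ S′))) (Top.total T))
                   (sym (trans (cong (_+ m * b) (sym (sum-++ C R))) (Bottom.total X))))
        (ring (sum C) a (sum S′) (sum R) n b m)
        where
        ring : ∀ c a s r n b m → a + s + ((n + b) + ((c + r) + m * b)) ≡ r + suc m * b + ((c + (a + s)) + n)
        ring = solve-∀
      b≤a : b ≤ a
      b≤a = +-cancelʳ-≤ (sum S′) b a (begin
        b + sum S′          ≤⟨ +-monoʳ-≤ b (sum≤length*bound (All.map Q≤b allS′)) ⟩
        b + length S′ * b   ≤⟨ +-monoʳ-≤ b (*-monoˡ-≤ b short) ⟩
        suc m * b           ≤⟨ m≤n+m _ (sum R) ⟩
        sum R + suc m * b   ≡⟨ difference ⟨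
        a + sum S′          ∎)
        where open ≤-Reasoning

    many : m < length S′ → ⊥
    many long =
      let u , z , v , eq , pos , b∣ = zero-sum-block b (C ++ (R ++ map (b ∸_) S′)) (enough long)
      in locate u z v (sym eq) pos b∣

    impossible : ⊥
    impossible = [ few , many ]′ (≤-<-connex (length S′) m)

  Top-remove : ∀ {t z l} → t ≤ p → 0 < length z → b ∣ sum z → Top (suc t) (z ++ l) → Top t l
  Top-remove {t} {z} {l} t≤p pos (divides zero sz) (top al eq len) =
    top (++⁻ʳ z al)
      (trans (sym (trans (sum-++ z l) (cong (_+ sum l) sz))) eq)
      (≤-pred (<-≤-trans (m<n+m (length l) pos) (subst (_≤ suc t) (length-++ z) len)))
  Top-remove {t} {z} {l} t≤p pos (divides (suc q) sz) (top al eq len) =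
    contradiction (bottom-long low) (≤⇒≯ (≤-pred (begin
      suc (length l + q)    ≡⟨ +-suc (length l) q ⟨
      length l + suc q      ≤⟨ +-monoʳ-≤ (length l) q<z ⟩
      length l + length z   ≡⟨ +-comm (length l) (length z) ⟩
      length z + length l   ≡⟨ length-++ z ⟨
      length (z ++ l)       ≤⟨ len ⟩
      suc t                 ≤⟨ s≤s t≤p ⟩
      suc p                 ∎)))
    where
    open ≤-Reasoning
    q<z : suc q ≤ length z
    q<z = *-cancelʳ-≤ (suc q) (length z) b (subst (_≤ length z * b) sz (sum≤length*bound (All.map Q≤b (++⁻ˡ z al))))
    low : Bottom l
    low = bottom (++⁻ʳ z al) q (+-combine _ _ (cong₂ _+_ eq (cong₂ _+_ (sym (sum-++ z l)) (sym sz))) (ring (sum z) (sum l) (sum (z ++ l)) q n b))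
      where
      ring : ∀ z l zl q n b → l + q * b + ((n + b) + (zl + z)) ≡ n + (zl + ((z + l) + suc q * b))
      ring = solve-∀

  -- Without S all of T is contained in X, although ΣT = n + b exceeds n ≥ ΣX.
  suffix-nonempty : ∀ {t C R} → Top t (C ++ []) → Bottom (C ++ R) → ⊥
  suffix-nonempty {C = C} {R} T X = <⇒≱ (m<m+n n (>-nonZero⁻¹ b)) (begin
    n + b                             ≡⟨ Top.total T ⟨
    sum (C ++ [])                     ≡⟨ cong sum (++-identityʳ C) ⟩
    sum C                             ≤⟨ m≤m+n (sum C) (sum R) ⟩
    sum C + sum R                     ≡⟨ sum-++ C R ⟨
    sum (C ++ R)                      ≤⟨ m≤m+n _ _ ⟩
    sum (C ++ R) + Bottom.deficit X * b  ≡⟨ Bottom.total X ⟩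
    n                                 ∎)
    where open ≤-Reasoning

  descend-step : ∀ {t k} → Reduce t → Descend t k → Descend t (suc k)
  descend-step reduce descend C []      R T X R<k = suffix-nonempty {C = C} T X
  descend-step reduce descend C (a ∷ S) R T X R<k = Step.impossible reduce C S R a
    (λ C′ S′ R′ T′ X′ R′<R → descend C′ S′ R′ T′ X′ (<-≤-trans R′<R (≤-pred R<k))) T X

  descend : ∀ {t} → Reduce t → ∀ k → Descend t k
  descend reduce (suc k) = descend-step reduce (descend reduce k)

  -- Removing the block leaves a T with at most `t` terms; the descent then starts afresh from X =
  -- `R₀` with empty common part.
  reduce : ∀ t → t ≤ suc p → Reduce t
  reduce zero    _    (_ ∷ _) l pos b∣ (top _ _ ())
  reduce (suc t) t≤p z l pos b∣ T =
    descend (reduce t (m≤n⇒m≤1+n (≤-pred t≤p))) (suc (length R₀)) [] l R₀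
      (Top-remove {z = z} (≤-pred t≤p) pos b∣ T)
      (bottom allR₀ 0 (trans (+-identityʳ (sum R₀)) sumR₀)) ≤-refl

  no-top : ∀ l → Top (suc p) l → ⊥
  no-top l T = descend (reduce (suc p) ≤-refl) (suc (length R₀)) [] l R₀ T
    (bottom allR₀ 0 (trans (+-identityʳ (sum R₀)) sumR₀)) ≤-refl

-- Intersection and union of the two translates

Sums-++ : ∀ {Q h h′ x x′} → Sums Q h x → Sums Q h′ x′ → Sums Q (h + h′) (x + x′)
Sums-++ (l , al , refl , refl) (l′ , al′ , refl , refl) =
  l ++ l′ , ++⁺ al al′ , length-++ l , sum-++ l l′

Sums-replicate : ∀ {Q : ℕ → Set} k {a} → Q a → Sums Q k (k * a)
Sums-replicate k {a} qa = replicate k a , replicate⁺ k qa , length-replicate k , sum-replicate k a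

module _ {Q : ℕ → Set} {b : ℕ} .{{_ : NonZero b}} (Q0 : Q 0) (Qb : Q b) (Q≤b : ∀ {a} → Q a → a ≤ b) where

  -- The conclusion is doubly negated because the exchange argument refutes `¬ Sums Q p n`, and `Q`
  -- is an arbitrary predicate.
  Sums-∩⁺ : ∀ {p n} → b ≤ 2 + p → Sums Q (suc p) n → Sums Q (suc p) (n + b) → ¬ ¬ Sums Q p n
  Sums-∩⁺ {p} {n} b≤ (r , allr , _ , sumr) (l , alll , lenl , suml) n∉pQ =
    Exchange.no-top Q b Q0 Qb Q≤b p n b≤ n∉pQ r allr sumr l (Exchange.top alll suml (≤-reflexive lenl))

  -- A zero-sum block of sum q b is traded for q copies of b and some zeros.
  Sums-∪⁺ : ∀ {h x} → b ≤ suc h → Sums Q (suc h) x → Sums Q h x ⊎ ∃[ y ] Sums Q h y × (y + b ≡ x)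
  Sums-∪⁺ {h} b≤ (l , al , len , refl)
    with u , z , v , refl , pos , divides q sz ← zero-sum-block b l (subst (b ≤_) (sym len) b≤)
    with allzv ← ++⁻ʳ u al =
    case m≤n⇒m<n∨m≡n q≤z of λ where
      -- There is room for at least one padding zero, and one is omitted.
      (inj₁ q<z) → let k , q+k = m≤n⇒∃[o]m+o≡n q<z in
        inj₁ (subst₂ (Sums Q)
          (suc-injective (trans (ring₁ (length u) q k (length v)) (trans (cong (λ c → length u + (c + length v)) q+k) lenuzv)))
          (trans (ring₂ (sum u) (q * b) k (sum v)) (trans (cong (λ c → sum u + (c + sum v)) (sym sz)) (sym sumuzv)))
          (fill q k))
      -- All terms of the block become `b`, and one of them is omitted.
      (inj₂ q≡z) → let q′ , q≡ = m≤n⇒∃[o]m+o≡n (subst (0 <_) (sym q≡z) pos) in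
        inj₂ (_ , subst (λ c → Sums Q c (sum u + (q′ * b + (0 + sum v))))
            (suc-injective (trans (ring₁ (length u) q′ 0 (length v)) (trans (cong (λ c → length u + (c + length v)) (trans (+-identityʳ (suc q′)) (trans q≡ q≡z))) lenuzv)))
            (fill q′ 0) ,
          trans (ring₃ (sum u) q′ b (sum v)) (trans (cong (λ c → sum u + (c + sum v)) (trans (cong (_* b) q≡) (sym sz))) (sym sumuzv)))
    where
    q≤z : q ≤ length z
    q≤z = *-cancelʳ-≤ q (length z) b (subst (_≤ length z * b) sz (sum≤length*bound (All.map Q≤b (++⁻ˡ z allzv))))
    fill : ∀ q k → Sums Q (length u + (q + (k + length v))) (sum u + (q * b + (k * 0 + sum v)))
    fill q k = Sums-++ (u , ++⁻ˡ u al , refl , refl) (Sums-++ (Sums-replicate q Qb)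
      (Sums-++ (Sums-replicate k Q0) (v , ++⁻ʳ z allzv , refl , refl)))
    lenuzv : length u + (length z + length v) ≡ suc h
    lenuzv = trans (sym (trans (length-++ u) (cong (_+_ (length u)) (length-++ z)))) len
    sumuzv : sum (u ++ (z ++ v)) ≡ sum u + (sum z + sum v)
    sumuzv = trans (sum-++ u _) (cong (_+_ (sum u)) (sum-++ z v))
    ring₁ : ∀ u q k v → suc (u + (q + (k + v))) ≡ u + (suc q + k + v)
    ring₁ = solve-∀
    ring₂ : ∀ u q k v → u + (q + (k * 0 + v)) ≡ u + (q + v)
    ring₂ = solve-∀
    ring₃ : ∀ u q b v → (u + (q * b + (0 + v))) + b ≡ u + (suc q * b + v)
    ring₃ = solve-∀

module _ {Q : ℕ → Set} (Q0 : Q 0) where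

  Sums-zero : ∀ h → Sums Q h 0
  Sums-zero h = subst (Sums Q h) (*-zeroʳ h) (Sums-replicate h Q0)

  Sums-≤0 : (∀ {a} → Q a → a ≤ 0) → ∀ {h x} → Sums Q h x → x ≡ 0
  Sums-≤0 Q≤0 (l , al , refl , refl) =
    n≤0⇒n≡0 (subst (sum l ≤_) (*-zeroʳ (length l)) (sum≤length*bound (All.map Q≤0 al)))

  Sums-∩ : ∀ {b} → Q b → (∀ {a} → Q a → a ≤ b) → ∀ {p n} → b ≤ 2 + p →
    Sums Q (suc p) n → Sums Q (suc p) (n + b) → ¬ ¬ Sums Q p n
  Sums-∩ {zero}  Qb Q≤0 {p} _ s _ n∉ with refl ← Sums-≤0 Q≤0 s = n∉ (Sums-zero p)
  Sums-∩ {suc _} Qb Q≤b = Sums-∩⁺ Q0 Qb Q≤b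

  Sums-∪ : ∀ {b} → Q b → (∀ {a} → Q a → a ≤ b) → ∀ {h x} → b ≤ suc h →
    Sums Q (suc h) x → Sums Q h x ⊎ ∃[ y ] Sums Q h y × (y + b ≡ x)
  Sums-∪ {zero}  Qb Q≤0 {h} _ s with refl ← Sums-≤0 Q≤0 s = inj₁ (Sums-zero h)
  Sums-∪ {suc _} Qb Q≤b = Sums-∪⁺ Q0 Qb Q≤b

-- Second differences of sumset sizes

open GroupProperties (AbelianGroup.group ℤ.+-0-abelianGroup) using (∙-cancelˡ)

lookup-injective : ∀ {X : Set} {xs : List X} → Unique xs → ∀ i j → List.lookup xs i ≡ List.lookup xs j → i ≡ j
lookup-injective (x∉ ∷ _) Fin.zero    Fin.zero    eq = refl
lookup-injective (x∉ ∷ _) Fin.zero    (Fin.suc j) eq = contradiction eq (All.lookup x∉ (∈-lookup j))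
lookup-injective (x∉ ∷ _) (Fin.suc i) Fin.zero    eq = contradiction (sym eq) (All.lookup x∉ (∈-lookup i))
lookup-injective (_ ∷ u)  (Fin.suc i) (Fin.suc j) eq = cong Fin.suc (lookup-injective u i j eq)

unique-⊆⇒length≤ : ∀ {X : Set} {xs ys : List X} → Unique xs → xs ⊆ ys → length xs ≤ length ys
unique-⊆⇒length≤ {X} {xs} {ys} u sub = Fin.injective⇒≤ {f = λ i → index (sub (∈-lookup i))} λ {i} {j} eq →
  lookup-injective u i j (index-injective (sub (∈-lookup i)) (sub (∈-lookup j)) eq)
  where
  index-injective : ∀ {x y} (p : x ∈ ys) (q : y ∈ ys) → index p ≡ index q → x ≡ y
  index-injective = index-injectiveₛ (setoid X)

length-filter-¬ : ∀ {X : Set} {P : X → Set} (P? : Decidable P) xs →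
  length (filter P? xs) + length (filter (¬? ∘ P?) xs) ≡ length xs
length-filter-¬ P? [] = refl
length-filter-¬ P? (x ∷ xs) with P? x
... | yes _ = cong suc (length-filter-¬ P? xs)
... | no  _ = trans (+-suc _ _) (cong suc (length-filter-¬ P? xs))

-- The part of `ws` outside `P` is disjoint from `is`, so the two fit side by side into `vs`; the
-- rest of `ws` fits into `us`. Both directions of inclusion-exclusion and the final comparison of
-- sizes are instances.
length-exchange : ∀ {X : Set} {P : X → Set} (P? : Decidable P) {ws is us vs : List X} →
  Unique ws → Unique is →
  (∀ {x} → x ∈ ws → P x → x ∈ us) → (∀ {x} → x ∈ ws → ¬ P x → x ∈ vs) →
  (∀ {x} → x ∈ is → x ∈ vs × (x ∈ ws → P x)) →
  length ws + length is ≤ length us + length vs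
length-exchange P? {ws} {is} {us} {vs} uw ui P⊆ ¬P⊆ I⊆ = begin
  length ws + length is
    ≡⟨ cong (_+ length is) (length-filter-¬ P? ws) ⟨
  length (filter P? ws) + length (filter (¬? ∘ P?) ws) + length is
    ≡⟨ +-assoc (length (filter P? ws)) _ _ ⟩
  length (filter P? ws) + (length (filter (¬? ∘ P?) ws) + length is)
    ≡⟨ cong (λ k → length (filter P? ws) + k) (length-++ (filter (¬? ∘ P?) ws)) ⟨
  length (filter P? ws) + length (filter (¬? ∘ P?) ws ++ is)
    ≤⟨ +-mono-≤
         (unique-⊆⇒length≤ (Unique.filter⁺ P? uw) λ x∈ → let x∈w , px = ∈-filter⁻ P? x∈ in P⊆ x∈w px)
         (unique-⊆⇒length≤
           (Unique.++⁺ (Unique.filter⁺ (¬? ∘ P?) uw) ui λ (x∈f , x∈i) →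
             let x∈w , ¬px = ∈-filter⁻ (¬? ∘ P?) x∈f in ¬px (proj₂ (I⊆ x∈i) x∈w))
           λ x∈ → [ (λ x∈f → let x∈w , ¬px = ∈-filter⁻ (¬? ∘ P?) x∈f in ¬P⊆ x∈w ¬px)
                  , (λ x∈i → proj₁ (I⊆ x∈i)) ]′ (∈-++⁻ (filter (¬? ∘ P?) ws) x∈)) ⟩
  length us + length vs ∎
  where open ≤-Reasoning

-- Elements of iterated sumsets

elements : FiniteSet → List ℤ
elements = deduplicate ℤ._≟_

elements-! : ∀ X → Unique (elements X)
elements-! = deduplicate-!

∈-elements⁺ : ∀ {X x} → x ∈ X → x ∈ elements X
∈-elements⁺ = ∈-deduplicate⁺ ℤ._≟_

∈-elements⁻ : ∀ {X x} → x ∈ elements X → x ∈ X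
∈-elements⁻ {X} = ∈-deduplicate⁻ ℤ._≟_ X

∣∣-mono : ∀ {X Y} → X ⊆ Y → ∣ X ∣ ≤ ∣ Y ∣
∣∣-mono {X} X⊆Y = unique-⊆⇒length≤ (elements-! X) (∈-elements⁺ ∘ X⊆Y ∘ ∈-elements⁻)

∈-sumset-suc⁺ : ∀ h {A x y} → x ∈ A → y ∈ sumset h A → x ℤ.+ y ∈ sumset (suc h) A
∈-sumset-suc⁺ h x∈A y∈ with _ , v∈ , refl ← ∈-map⁻ _ y∈ =
  ∈-map⁺ (Vec.foldr′ ℤ._+_ 0ℤ) (∈-cartesianProductWith⁺ Vec._∷_ x∈A v∈)

∈-sumset-suc⁻ : ∀ h {A z} → z ∈ sumset (suc h) A → ∃[ x ] ∃[ y ] x ∈ A × y ∈ sumset h A × z ≡ x ℤ.+ y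
∈-sumset-suc⁻ h {A} z∈ with _ , v∈ , refl ← ∈-map⁻ _ z∈
  with x , v , x∈ , v∈′ , refl ← ∈-cartesianProductWith⁻ Vec._∷_ A (tuples h A) v∈ =
  x , _ , x∈ , ∈-map⁺ _ v∈′ , refl

Shifted : ℤ → FiniteSet → ℕ → Set
Shifted α A a = α ℤ.+ + a ∈ A

-- The sum of `h` elements `α + a` whose offsets `a` have sum `x`.
shift : ℤ → ℕ → ℕ → ℤ
shift α h x = + h ℤ.* α ℤ.+ + x

shift-suc : ∀ α h a x → (α ℤ.+ + a) ℤ.+ shift α h x ≡ shift α (suc h) (a + x)
shift-suc α h a x = trans (ring α (+ h) (+ a) (+ x)) refl
  where
  ring : ∀ α h a x → (α ℤ.+ a) ℤ.+ (h ℤ.* α ℤ.+ x) ≡ (ℤ.1ℤ ℤ.+ h) ℤ.* α ℤ.+ (a ℤ.+ x)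
  ring = ℤ-solve-∀

shift-injective : ∀ α h {x y} → shift α h x ≡ shift α h y → x ≡ y
shift-injective α h eq = ℤ.+-injective (∙-cancelˡ (+ h ℤ.* α) _ _ eq)

∈-sumset⁺ : ∀ α {A} h {x} → Sums (Shifted α A) h x → shift α h x ∈ sumset h A
∈-sumset⁺ α zero ([] , [] , refl , refl) = here refl
∈-sumset⁺ α {A} (suc h) (a ∷ l , a∈ ∷ al , len , refl) = subst (_∈ sumset (suc h) A) (shift-suc α h a (sum l))
  (∈-sumset-suc⁺ h a∈ (∈-sumset⁺ α h (l , al , suc-injective len , refl)))

∈-sumset⁻ : ∀ α {A} → (∀ {x} → x ∈ A → ∃[ a ] x ≡ α ℤ.+ + a) →
  ∀ h {z} → z ∈ sumset h A → ∃[ x ] z ≡ shift α h x × Sums (Shifted α A) h x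
∈-sumset⁻ α rep zero (here refl) = 0 , refl , [] , [] , refl , refl
∈-sumset⁻ α rep (suc h) z∈ with x , y , x∈ , y∈ , refl ← ∈-sumset-suc⁻ h z∈
  with a , refl ← rep x∈ | s , refl , l , al , refl , refl ← ∈-sumset⁻ α rep h y∈ =
  a + s , shift-suc α h a s , a ∷ l , x∈ ∷ al , refl , refl

module SecondDifference {α : ℤ} {b : ℕ} {A : FiniteSet}
  (α∈ : α ∈ A) (β∈ : α ℤ.+ + b ∈ A) (rep : ∀ {x} → x ∈ A → ∃[ a ] (x ≡ α ℤ.+ + a) × (a ≤ b))
  {h : ℕ} (b≤ : b ≤ 2 + h) where

  β : ℤ
  β = α ℤ.+ + b

  low mid high lower upper both : List ℤ
  low   = elements (sumset h A)
  mid   = elements (sumset (suc h) A)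
  high  = elements (sumset (2 + h) A)
  lower = map (ℤ._+_ α) mid
  upper = map (ℤ._+_ β) mid
  both  = map (ℤ._+_ (α ℤ.+ β)) low

  α+0∈ : Shifted α A 0
  α+0∈ = subst (_∈ A) (sym (ℤ.+-identityʳ α)) α∈

  ≤b : ∀ {a} → Shifted α A a → a ≤ b
  ≤b a∈ with a′ , eq , a′≤b ← rep a∈ = subst (_≤ b) (sym (ℤ.+-injective (∙-cancelˡ α _ _ eq))) a′≤b

  sumset⁻ : ∀ k {z} → z ∈ sumset k A → ∃[ x ] z ≡ shift α k x × Sums (Shifted α A) k x
  sumset⁻ = ∈-sumset⁻ α λ x∈ → let a , eq , _ = rep x∈ in a , eq

  α+shift : ∀ k x → α ℤ.+ shift α k x ≡ shift α (suc k) x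
  α+shift k x = trans (cong (ℤ._+ shift α k x) (sym (ℤ.+-identityʳ α))) (shift-suc α k 0 x)

  lower⊆high : lower ⊆ high
  lower⊆high z∈ with x , x∈ , refl ← ∈-map⁻ _ z∈ = ∈-elements⁺ (∈-sumset-suc⁺ (suc h) α∈ (∈-elements⁻ x∈))

  upper⊆high : upper ⊆ high
  upper⊆high z∈ with x , x∈ , refl ← ∈-map⁻ _ z∈ = ∈-elements⁺ (∈-sumset-suc⁺ (suc h) β∈ (∈-elements⁻ x∈))

  both⊆lower : both ⊆ lower
  both⊆lower z∈ with x , x∈ , refl ← ∈-map⁻ _ z∈ = subst (_∈ lower) (sym (ℤ.+-assoc α β x))
    (∈-map⁺ (ℤ._+_ α) (∈-elements⁺ (∈-sumset-suc⁺ h β∈ (∈-elements⁻ x∈))))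

  both⊆upper : both ⊆ upper
  both⊆upper z∈ with x , x∈ , refl ← ∈-map⁻ _ z∈ = subst (_∈ upper) (ring α β x)
    (∈-map⁺ (ℤ._+_ β) (∈-elements⁺ (∈-sumset-suc⁺ h α∈ (∈-elements⁻ x∈))))
    where
    ring : ∀ α β x → β ℤ.+ (α ℤ.+ x) ≡ α ℤ.+ β ℤ.+ x
    ring = ℤ-solve-∀

  high⊆lower∪upper : ∀ {z} → z ∈ high → z ∈ lower ⊎ z ∈ upper
  high⊆lower∪upper z∈ with x , refl , s ← sumset⁻ (2 + h) (∈-elements⁻ z∈) with Sums-∪ α+0∈ β∈ ≤b b≤ s
  ... | inj₁ s′ = inj₁ (subst (_∈ lower) (α+shift (suc h) x)
    (∈-map⁺ (ℤ._+_ α) (∈-elements⁺ (∈-sumset⁺ α (suc h) s′))))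
  ... | inj₂ (y , s′ , refl) = inj₂ (subst (_∈ upper) (trans (shift-suc α (suc h) b y) (cong (shift α (2 + h)) (+-comm b y)))
    (∈-map⁺ (ℤ._+_ β) (∈-elements⁺ (∈-sumset⁺ α (suc h) s′))))

  -- A common point comes from offsets y + b and y that are both sums of h + 1 terms, so y is a sum
  -- of `h` terms. Membership in a list is decidable, which removes the double negation.
  lower∩upper⊆both : ∀ {z} → z ∈ lower → z ∈ upper → z ∈ both
  lower∩upper⊆both z∈l z∈u
    with u , u∈ , refl ← ∈-map⁻ _ z∈l | v , v∈ , eq ← ∈-map⁻ _ z∈u
    with x , refl , sx ← sumset⁻ (suc h) (∈-elements⁻ u∈) | y , refl , sy ← sumset⁻ (suc h) (∈-elements⁻ v∈)
    with refl ← shift-injective α (2 + h) (trans (trans (sym (α+shift (suc h) x)) eq) (trans (shift-suc α (suc h) b y) (cong (shift α (2 + h)) (+-comm b y)))) =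
    subst (_∈ both) (trans (ring α (+ b) (shift α h y)) (trans (cong (ℤ._+_ β) (α+shift h y)) (sym eq)))
      (∈-map⁺ (ℤ._+_ (α ℤ.+ β)) (∈-elements⁺ (decidable-stable (shift α h y ∈? sumset h A)
        λ ∉ → Sums-∩ α+0∈ β∈ ≤b b≤ sy sx (∉ ∘ ∈-sumset⁺ α h))))
    where
    ring : ∀ α b s → α ℤ.+ (α ℤ.+ b) ℤ.+ s ≡ (α ℤ.+ b) ℤ.+ (α ℤ.+ s)
    ring = ℤ-solve-∀

  map-+-! : ∀ γ k → Unique (map (ℤ._+_ γ) (elements (sumset k A)))
  map-+-! γ k = Unique.map⁺ (∙-cancelˡ γ _ _) (elements-! (sumset k A))

  -- The translates cover `high`, and their intersection contains `both`.
  concave : length high + length low ≤ length mid + length mid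
  concave = subst₂ _≤_ (cong (λ k → length high + k) (length-map _ low)) (cong₂ _+_ (length-map _ mid) (length-map _ mid))
    (length-exchange (_∈? lower) (elements-! (sumset (2 + h) A)) (map-+-! (α ℤ.+ β) h)
      (λ _ z∈l → z∈l)
      (λ z∈ z∉l → [ (λ z∈l → contradiction z∈l z∉l) , id ]′ (high⊆lower∪upper z∈))
      (λ z∈ → both⊆upper z∈ , λ _ → both⊆lower z∈))

  -- The translates lie in `high`, and their intersection is contained in `both`.
  convex : length mid + length mid ≤ length low + length high
  convex = subst₂ _≤_ (cong₂ _+_ (length-map _ mid) (length-map _ mid)) (cong (_+ length high) (length-map _ low))
    (length-exchange (_∈? lower) (map-+-! β (suc h)) (map-+-! α (suc h))
      (λ z∈u z∈l → lower∩upper⊆both z∈l z∈u)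
      (λ z∈u _ → upper⊆high z∈u)
      (λ z∈l → lower⊆high z∈l , λ _ → z∈l))

  linear : length high + length low ≡ length mid + length mid
  linear = ≤-antisym concave (≤-trans convex (≤-reflexive (+-comm (length low) (length high))))

-- The lower bound

0<⊖⇒> : ∀ m n → 0ℤ ℤ.< m ⊖ n → n < m
0<⊖⇒> m n 0< = ≰⇒> λ m≤n → ℤ.<⇒≱ 0< (subst (m ⊖ n ℤ.≤_) (ℤ.n⊖n≡0 n) (ℤ.⊖-monoˡ-≤ n m≤n))

⊖<0⇒< : ∀ m n → m ⊖ n ℤ.< 0ℤ → m < n
⊖<0⇒< m n <0 = ≰⇒> λ n≤m → ℤ.<⇒≱ <0 (subst (ℤ._≤ m ⊖ n) (ℤ.n⊖n≡0 n) (ℤ.⊖-monoˡ-≤ n n≤m))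

>⇒0<⊖ : ∀ m n → n < m → 0ℤ ℤ.< m ⊖ n
>⇒0<⊖ m n n<m = subst (ℤ._< m ⊖ n) (ℤ.n⊖n≡0 n) (ℤ.⊖-monoˡ-< n n<m)

<⇒⊖<0 : ∀ m n → m < n → m ⊖ n ℤ.< 0ℤ
<⇒⊖<0 m n m<n = subst (m ⊖ n ℤ.<_) (ℤ.n⊖n≡0 n) (ℤ.⊖-monoˡ-< n m<n)

≤⇒∃+ : ∀ {i j} → i ℤ.≤ j → ∃[ a ] j ≡ i ℤ.+ + a
≤⇒∃+ {i} {j} i≤j = ℤ.∣ j ℤ.- i ∣ , (begin
  j                            ≡⟨ ring i j ⟩
  i ℤ.+ (j ℤ.- i)              ≡⟨ cong (ℤ._+_ i) (ℤ.0≤i⇒+∣i∣≡i (ℤ.i≤j⇒0≤j-i i≤j)) ⟨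
  i ℤ.+ + ℤ.∣ j ℤ.- i ∣        ∎)
  where
  open ≡-Reasoning
  ring : ∀ i j → j ≡ i ℤ.+ (j ℤ.- i)
  ring = ℤ-solve-∀

min∈ : ∀ x xs → min x xs ∈ x ∷ xs
min∈ x xs = [ here , there ]′ (argmin-sel id x xs)

max∈ : ∀ x xs → max x xs ∈ x ∷ xs
max∈ x xs = [ here , there ]′ (argmax-sel id x xs)

-- The end points are the minimum and maximum of A, whose difference is at most N. Three consecutive
-- sizes start at 1 + h, where the empty set also obeys the equation.
sumset-sizes-linear : ∀ {N h A} → A ⊆[ 0ℤ , + N ] → N ≤ 3 + h →
  ∣ sumset (3 + h) A ∣ + ∣ sumset (1 + h) A ∣ ≡ ∣ sumset (2 + h) A ∣ + ∣ sumset (2 + h) A ∣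
sumset-sizes-linear {A = []} _ _ = refl
sumset-sizes-linear {N} {h} {A = x ∷ xs} A⊆ N≤ with b , β≡ ← ≤⇒∃+ (ℤ.≤-trans (min≤⊤ x xs) (⊥≤max x xs)) =
  SecondDifference.linear (min∈ x xs) (subst (_∈ x ∷ xs) β≡ (max∈ x xs)) rep (≤-trans b≤N N≤)
  where
  α β : ℤ
  α = min x xs
  β = max x xs
  α≤ : All (α ℤ.≤_) (x ∷ xs)
  α≤ = min≤⊤ x xs ∷ min≤xs x xs
  ≤β : All (ℤ._≤ β) (x ∷ xs)
  ≤β = ⊥≤max x xs ∷ xs≤max x xs
  rep : ∀ {y} → y ∈ x ∷ xs → ∃[ a ] (y ≡ α ℤ.+ + a) × (a ≤ b)
  rep y∈ with a , refl ← ≤⇒∃+ (All.lookup α≤ y∈) =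
    a , refl , ≮⇒≥ λ b<a → ℤ.<⇒≱ (ℤ.+-monoʳ-< α (ℤ.+<+ b<a)) (subst (α ℤ.+ + a ℤ.≤_) β≡ (All.lookup ≤β y∈))
  b≤N : b ≤ N
  b≤N = ℤ.drop‿+≤+ (begin
    + b             ≡⟨ ℤ.+-identityˡ (+ b) ⟨
    0ℤ ℤ.+ + b      ≤⟨ ℤ.+-monoˡ-≤ (+ b) (proj₁ (All.lookup A⊆ (min∈ x xs))) ⟩
    α ℤ.+ + b       ≡⟨ β≡ ⟨
    β               ≤⟨ proj₂ (All.lookup A⊆ (max∈ x xs)) ⟩
    + N             ∎)
    where open ℤ.≤-Reasoning

-- With 3 + h signs counted from 0, only the last but one is negative.
tail-sign : ℕ → ℕ → Sign
tail-sign zero    zero          = Sign.+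
tail-sign zero    (suc zero)    = Sign.-
tail-sign zero    (suc (suc _)) = Sign.+
tail-sign (suc h) zero          = Sign.+
tail-sign (suc h) (suc k)       = tail-sign h k

tail-sign-0 : ∀ h → tail-sign h h ≡ Sign.+
tail-sign-0 zero    = refl
tail-sign-0 (suc h) = tail-sign-0 h

tail-sign-1 : ∀ h → tail-sign h (1 + h) ≡ Sign.-
tail-sign-1 zero    = refl
tail-sign-1 (suc h) = tail-sign-1 h

tail-sign-2 : ∀ h → tail-sign h (2 + h) ≡ Sign.+
tail-sign-2 zero    = refl
tail-sign-2 (suc h) = tail-sign-2 h

-- The last three sizes have second difference 0 for both sets, whereas the signs +, -, + force that
-- of A to be larger than that of B.
realized⇒H<N : ∀ {N H} → H ≥ 3 → AllSignsRealizedIn[0, N ] H → H < N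
realized⇒H<N {N} {suc (suc (suc h))} (s≤s (s≤s (s≤s z≤n))) realized = ≰⇒> λ N≤ → go N≤ (realized (tabulate (tail-sign h ∘ toℕ)))
  where
  go : N ≤ 3 + h → _ → ⊥
  go N≤ (A , B , A⊆ , B⊆ , signs) = <⇒≱ (+-mono-< D₀ D₂) (begin
    ∣ sumset (1 + h) A ∣ + ∣ sumset (3 + h) A ∣ ≡⟨ +-comm ∣ sumset (1 + h) A ∣ _ ⟩
    ∣ sumset (3 + h) A ∣ + ∣ sumset (1 + h) A ∣ ≡⟨ sumset-sizes-linear A⊆ N≤ ⟩
    ∣ sumset (2 + h) A ∣ + ∣ sumset (2 + h) A ∣ ≤⟨ <⇒≤ (+-mono-< D₁ D₁) ⟩
    ∣ sumset (2 + h) B ∣ + ∣ sumset (2 + h) B ∣ ≡⟨ sumset-sizes-linear B⊆ N≤ ⟨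
    ∣ sumset (3 + h) B ∣ + ∣ sumset (1 + h) B ∣ ≡⟨ +-comm ∣ sumset (3 + h) B ∣ _ ⟩
    ∣ sumset (1 + h) B ∣ + ∣ sumset (3 + h) B ∣ ∎)
    where
    open ≤-Reasoning
    sign-at : ∀ {k} → k < 3 + h → ∀ {s} → tail-sign h k ≡ s →
      HasSign s (∣ sumset (suc k) A ∣ ⊖ ∣ sumset (suc k) B ∣)
    sign-at {k} k< refl = subst
      (λ j → HasSign (tail-sign h j) (∣ sumset (suc j) A ∣ ⊖ ∣ sumset (suc j) B ∣)) (Fin.toℕ-fromℕ< k<)
      (subst (λ s → HasSign s (∣ sumset (suc (toℕ (fromℕ< k<))) A ∣ ⊖ ∣ sumset (suc (toℕ (fromℕ< k<))) B ∣))
        (lookup∘tabulate (tail-sign h ∘ toℕ) (fromℕ< k<)) (signs (fromℕ< k<)))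
    D₀ : ∣ sumset (1 + h) B ∣ < ∣ sumset (1 + h) A ∣
    D₀ = 0<⊖⇒> _ _ (sign-at (m≤n+m (suc h) 2) (tail-sign-0 h))
    D₁ : ∣ sumset (2 + h) A ∣ < ∣ sumset (2 + h) B ∣
    D₁ = ⊖<0⇒< _ _ (sign-at (n≤1+n _) (tail-sign-1 h))
    D₂ : ∣ sumset (3 + h) B ∣ < ∣ sumset (3 + h) A ∣
    D₂ = 0<⊖⇒> _ _ (sign-at ≤-refl (tail-sign-2 h))

-- Decidability of realization

-- Turns the constructed N into the minimum that the graph of ν asks for; decidability makes the
-- search constructive.
least : ∀ {P : ℕ → Set} → Decidable P → ∀ n → P n → ∃[ m ] P m × (∀ k → P k → m ≤ k)
least {P} P? n pn = [ id , (λ none → contradiction pn (none ≤-refl)) ]′ (search (suc n))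
  where
  search : ∀ n → (∃[ m ] P m × (∀ k → P k → m ≤ k)) ⊎ (∀ {k} → k < n → ¬ P k)
  search zero = inj₂ λ ()
  search (suc n) with search n
  ... | inj₁ found = inj₁ found
  ... | inj₂ none with P? n
  ...   | yes p = inj₁ (n , p , λ k pk → ≮⇒≥ λ k<n → none k<n pk)
  ...   | no ¬p = inj₂ λ k<1+n pk → case m≤n⇒m<n∨m≡n (≤-pred k<1+n) of λ where
            (inj₁ k<n)  → none k<n pk
            (inj₂ refl) → ¬p pk

all-signs? : ∀ {H} {P : Vec Sign H → Set} → Decidable P → Dec (∀ ε → P ε)
all-signs? {zero}  P? = map′ (λ p → λ where Vec.[] → p) (λ f → f Vec.[]) (P? Vec.[])
all-signs? {suc H} P? = map′
  (λ (f , g) → λ where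
    (Sign.+ Vec.∷ ε) → f ε
    (Sign.- Vec.∷ ε) → g ε)
  (λ f → f ∘ (Sign.+ Vec.∷_) , f ∘ (Sign.- Vec.∷_))
  (all-signs? (P? ∘ (Sign.+ Vec.∷_)) ×-dec all-signs? (P? ∘ (Sign.- Vec.∷_)))

hasSign? : ∀ s z → Dec (HasSign s z)
hasSign? Sign.+ z = 0ℤ ℤ.<? z
hasSign? Sign.- z = z ℤ.<? 0ℤ

sumset-mono : ∀ h {A B} → A ⊆ B → sumset h A ⊆ sumset h B
sumset-mono zero    A⊆B z∈ = z∈
sumset-mono (suc h) A⊆B z∈ with x , y , x∈ , y∈ , refl ← ∈-sumset-suc⁻ h z∈ =
  ∈-sumset-suc⁺ h (A⊆B x∈) (sumset-mono h A⊆B y∈)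

module _ {N : ℕ} where

  fromSubset : Subset (suc N) → FiniteSet
  fromSubset s = map (+_ ∘ toℕ) (filter (λ i → lookup s i Bool.≟ true) (allFin (suc N)))

  fromSubset⊆ : ∀ s → fromSubset s ⊆[ 0ℤ , + N ]
  fromSubset⊆ s = All.tabulate λ x∈ → case ∈-map⁻ (+_ ∘ toℕ) x∈ of λ where
    (i , _ , refl) → ℤ.+≤+ z≤n , ℤ.+≤+ (Fin.toℕ≤pred[n] i)

  toSubset : FiniteSet → Subset (suc N)
  toSubset A = tabulate λ i → does (+ toℕ i ∈? A)

  fromSubset∘toSubset-⊆ : ∀ A → fromSubset (toSubset A) ⊆ A
  fromSubset∘toSubset-⊆ A x∈ with i , i∈ , refl ← ∈-map⁻ (+_ ∘ toℕ) x∈ =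
    witness (+ toℕ i ∈? A) (trans (sym (lookup∘tabulate (λ i → does (+ toℕ i ∈? A)) i))
      (proj₂ (∈-filter⁻ (λ i → lookup (toSubset A) i Bool.≟ true) {xs = allFin (suc N)} i∈)))
    where
    witness : ∀ {P : Set} (d : Dec P) → does d ≡ true → P
    witness (yes p) _ = p

  fromSubset∘toSubset-⊇ : ∀ {A} → A ⊆[ 0ℤ , + N ] → A ⊆ fromSubset (toSubset A)
  fromSubset∘toSubset-⊇ {A} A⊆ x∈ with All.lookup A⊆ x∈
  ... | ℤ.+≤+ {n = n} _ , ℤ.+≤+ n≤N = subst (_∈ fromSubset (toSubset A)) (cong +_ (Fin.toℕ-fromℕ< (s≤s n≤N)))
    (∈-map⁺ (+_ ∘ toℕ) (∈-filter⁺ (λ i → lookup (toSubset A) i Bool.≟ true) (∈-allFin i)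
      (trans (lookup∘tabulate (λ i → does (+ toℕ i ∈? A)) i) (dec-true (+ toℕ i ∈? A) (subst (_∈ A) (cong +_ (sym (Fin.toℕ-fromℕ< (s≤s n≤N)))) x∈)))))
    where
    i : Fin (suc N)
    i = fromℕ< (s≤s n≤N)

  ∣sumset-toSubset∣ : ∀ {A} → A ⊆[ 0ℤ , + N ] → ∀ h → ∣ sumset h A ∣ ≡ ∣ sumset h (fromSubset (toSubset A)) ∣
  ∣sumset-toSubset∣ {A} A⊆ h = ≤-antisym
    (∣∣-mono (sumset-mono h (fromSubset∘toSubset-⊇ A⊆)))
    (∣∣-mono (sumset-mono h (fromSubset∘toSubset-⊆ A)))

-- The definition ranges over infinitely many lists, but sizes depend only on the underlying sets,
-- and [0, N] has finitely many subsets.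
all-signs-realized? : ∀ H → Decidable (λ N → AllSignsRealizedIn[0, N ] H)
all-signs-realized? H N = all-signs? λ ε → map′
  (λ (s , t , signs) → fromSubset s , fromSubset t , fromSubset⊆ s , fromSubset⊆ t , signs)
  (λ (A , B , A⊆ , B⊆ , signs) → toSubset A , toSubset B , λ i →
    subst₂ (λ m n → HasSign (lookup ε i) (m ⊖ n)) (∣sumset-toSubset∣ A⊆ (suc (toℕ i))) (∣sumset-toSubset∣ B⊆ (suc (toℕ i))) (signs i))
  (anySubset? λ s → anySubset? λ t → Fin.all? λ i →
    hasSign? (lookup ε i) (∣ sumset (suc (toℕ i)) (fromSubset s) ∣ ⊖ ∣ sumset (suc (toℕ i)) (fromSubset t) ∣))

-- The upper bound

Sums-map : ∀ {Q Q′ : ℕ → Set} → (∀ {a} → Q a → Q′ a) → ∀ {h x} → Sums Q h x → Sums Q′ h x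
Sums-map f (l , al , len , eq) = l , All.map f al , len , eq

Sums-1 : ∀ {Q : ℕ → Set} {a} → Q a → Sums Q 1 a
Sums-1 {a = a} qa = a ∷ [] , qa ∷ [] , refl , +-identityʳ a

quotient-remainder-unique : ∀ M .{{_ : NonZero M}} q q′ {r r′} → r < M → r′ < M →
  q * M + r ≡ q′ * M + r′ → q ≡ q′ × r ≡ r′
quotient-remainder-unique M q q′ {r} {r′} r<M r′<M eq = q≡ , r≡
  where
  remainder : ∀ q {r} → r < M → (q * M + r) % M ≡ r
  remainder q {r} r<M = trans (cong (_% M) (+-comm (q * M) r)) (trans ([m+kn]%n≡m%n r q M) (m<n⇒m%n≡m r<M))
  r≡ : r ≡ r′
  r≡ = trans (sym (remainder q r<M)) (trans (cong (_% M) eq) (remainder q′ r′<M))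
  q≡ : q ≡ q′
  q≡ = *-cancelʳ-≡ q q′ M (+-cancelʳ-≡ r _ _ (trans eq (cong (λ k → q′ * M + k) (sym r≡))))

module Construction (H : ℕ) .{{_ : NonZero H}} where

  -- Offsets are at most 2 H and fewer than H ones are added to them, so a block with its sums stays
  -- inside one row of width M. Rows lie above (1 + H) M, so that two block points sum to at least
  -- K, and end by K.
  M K N : ℕ
  M = 3 * H
  K = (2 + (H + H)) * M
  N = K + K

  instance
    M≢0 : NonZero M
    M≢0 = m*n≢0 3 H

  rank row origin : Fin H → ℕ
  rank i  = suc (toℕ i)
  row i   = 1 + H + rank i
  origin i = row i * M

  middle : Sign → ℕ → ℕ
  middle Sign.+ k = k
  middle Sign.- k = suc k

  offsets : Sign → ℕ → List ℕ
  offsets s k = 0 ∷ middle s k ∷ k + k ∷ []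

  block : (Fin H → Sign) → Fin H → List ℕ
  block σ i = map (_+_ (origin i)) (offsets (σ i) (rank i))

  Point : (Fin H → Sign) → ℕ → Set
  Point σ x = x ≤ 1 ⊎ (K ≤ x ⊎ ∃[ i ] x ∈ block σ i)

  point? : ∀ σ → Decidable (Point σ)
  point? σ x = (x ≤? 1) ⊎-dec ((K ≤? x) ⊎-dec Fin.any? (λ i → x ℕ-List.∈? block σ i))

  S : (Fin H → Sign) → FiniteSet
  S σ = map +_ (filter (point? σ) (upTo (suc N)))

  Element : (Fin H → Sign) → ℕ → Set
  Element σ x = Point σ x × x ≤ N

  ∈-S⁺ : ∀ {σ x} → Element σ x → + x ∈ S σ
  ∈-S⁺ {σ} (p , x≤N) = ∈-map⁺ +_ (∈-filter⁺ (point? σ) (∈-upTo⁺ (s≤s x≤N)) p)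

  ∈-S⁻ : ∀ {σ z} → z ∈ S σ → ∃[ x ] z ≡ + x × Element σ x
  ∈-S⁻ {σ} z∈ with x , x∈ , refl ← ∈-map⁻ +_ z∈ with x∈up , p ← ∈-filter⁻ (point? σ) {xs = upTo (suc N)} x∈ =
    x , refl , p , ≤-pred (∈-upTo⁻ x∈up)

  S⊆ : ∀ σ → S σ ⊆[ 0ℤ , + N ]
  S⊆ σ = All.tabulate λ z∈ → case ∈-S⁻ {σ} z∈ of λ where
    (x , refl , _ , x≤N) → ℤ.+≤+ z≤n , ℤ.+≤+ x≤N

  shift-0 : ∀ h x → shift 0ℤ h x ≡ + x
  shift-0 h x = trans (cong (ℤ._+ + x) (ℤ.*-zeroʳ (+ h))) (ℤ.+-identityˡ (+ x))

  ∈-hS⁺ : ∀ σ h {x} → Sums (Element σ) h x → + x ∈ sumset h (S σ)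
  ∈-hS⁺ σ h {x} s = subst (_∈ sumset h (S σ)) (shift-0 h x) (∈-sumset⁺ 0ℤ h
    (Sums-map (λ {a} e → subst (_∈ S σ) (sym (ℤ.+-identityˡ (+ a))) (∈-S⁺ e)) s))

  ∈-hS⁻ : ∀ σ h {z} → z ∈ sumset h (S σ) → ∃[ x ] z ≡ + x × Sums (Element σ) h x
  ∈-hS⁻ σ h z∈ with x , refl , s ← ∈-sumset⁻ 0ℤ (λ z∈ → let x , eq , _ = ∈-S⁻ {σ} z∈ in x , trans eq (sym (ℤ.+-identityˡ (+ x)))) h z∈ =
    x , shift-0 h x , Sums-map (λ {a} a∈ → element (∈-S⁻ {σ} (subst (_∈ S σ) (ℤ.+-identityˡ (+ a)) a∈))) s
    where
    element : ∀ {a} → ∃[ x ] + a ≡ + x × Element σ x → Element σ a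
    element (_ , refl , e) = e

  -- The shape of the `h`-fold sumset, apart from its upper bound `h * N`, which is carried
  -- separately. Below K at most one term is a block point `y`, and the other h - 1 terms, each 0 or
  -- 1, contribute `e`.
  Reach : (Fin H → Sign) → ℕ → ℕ → Set
  Reach σ h x = x ≤ h ⊎ (K ≤ x ⊎ ∃[ i ] ∃[ y ] ∃[ e ] y ∈ block σ i × e < h × x ≡ y + e)

  rank≤H : ∀ i → rank i ≤ H
  rank≤H = Fin.toℕ<n

  row<2+H+H : ∀ i → row i < 2 + (H + H)
  row<2+H+H i = s≤s (s≤s (+-monoʳ-≤ H (rank≤H i)))

  origin-large : ∀ i → (1 + H) * M ≤ origin i
  origin-large i = *-monoˡ-≤ M (m≤m+n (1 + H) (rank i))

  offset≤ : ∀ s {k o} → 1 ≤ k → o ∈ offsets s k → o ≤ k + k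
  offset≤ s      1≤k (here refl)                 = z≤n
  offset≤ Sign.+ 1≤k (there (here refl))         = m≤m+n _ _
  offset≤ Sign.- 1≤k (there (here refl))         = +-monoˡ-≤ _ 1≤k
  offset≤ s      1≤k (there (there (here refl))) = ≤-refl

  ∈-block⁻ : ∀ σ i {y} → y ∈ block σ i → ∃[ o ] o ∈ offsets (σ i) (rank i) × y ≡ origin i + o
  ∈-block⁻ σ i = ∈-map⁻ (_+_ (origin i))

  block-large : ∀ σ i {y} → y ∈ block σ i → (1 + H) * M ≤ y
  block-large σ i y∈ with o , _ , refl ← ∈-block⁻ σ i y∈ = ≤-trans (origin-large i) (m≤m+n _ o)

  offset+tail<M : ∀ {k o e} → k ≤ H → o ≤ k + k → e < H → o + e < M
  offset+tail<M {k} {o} {e} k≤ o≤ e< = begin-strict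
    o + e             ≤⟨ +-monoˡ-≤ e (≤-trans o≤ (+-mono-≤ k≤ k≤)) ⟩
    H + H + e         <⟨ +-monoʳ-< (H + H) e< ⟩
    H + H + H         ≡⟨ ring H ⟩
    M                 ∎
    where
    open ≤-Reasoning
    ring : ∀ H → H + H + H ≡ 3 * H
    ring = solve-∀

  origin+r<K : ∀ i {r} → r < M → origin i + r < K
  origin+r<K i {r} r<M = begin-strict
    origin i + r         <⟨ +-monoʳ-< (origin i) r<M ⟩
    origin i + M         ≡⟨ +-comm (origin i) M ⟩
    suc (row i) * M     ≤⟨ *-monoˡ-≤ M (row<2+H+H i) ⟩
    K                   ∎
    where open ≤-Reasoning

  Sums⇒Reach : ∀ σ {h x} → Sums (Element σ) h x → Reach σ h x
  Sums⇒Reach σ ([] , [] , refl , refl) = inj₁ z≤n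
  Sums⇒Reach σ (a ∷ l , (p , _) ∷ al , refl , refl) = add p (Sums⇒Reach σ (l , al , refl , refl))
    where
    add : Point σ a → Reach σ (length l) (sum l) → Reach σ (suc (length l)) (a + sum l)
    add (inj₁ a≤1)        (inj₁ s≤)        = inj₁ (+-mono-≤ a≤1 s≤)
    add (inj₂ (inj₁ K≤a)) _                = inj₂ (inj₁ (≤-trans K≤a (m≤m+n a _)))
    add _                 (inj₂ (inj₁ K≤s)) = inj₂ (inj₁ (≤-trans K≤s (m≤n+m _ a)))
    add (inj₁ a≤1) (inj₂ (inj₂ (i , y , e , y∈ , e< , eq))) = inj₂ (inj₂ (i , y , a + e , y∈ , +-mono-≤-< a≤1 e< ,
      trans (cong (λ s → a + s) eq) (ring a y e)))
      where
      ring : ∀ a y e → a + (y + e) ≡ y + (a + e)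
      ring = solve-∀
    add (inj₂ (inj₂ (i , a∈))) (inj₁ s≤) = inj₂ (inj₂ (i , a , sum l , a∈ , s≤s s≤ , refl))
    -- Two block points already reach the absorbing interval.
    add (inj₂ (inj₂ (i , a∈))) (inj₂ (inj₂ (j , y , e , y∈ , _ , eq))) = inj₂ (inj₁ (begin
      K                             ≡⟨ ring H M ⟩
      (1 + H) * M + (1 + H) * M     ≤⟨ +-mono-≤ (block-large σ i a∈) (block-large σ j y∈) ⟩
      a + y                         ≤⟨ +-monoʳ-≤ a (m≤m+n y e) ⟩
      a + (y + e)                   ≡⟨ cong (λ s → a + s) eq ⟨
      a + sum l                     ∎))
      where
      open ≤-Reasoning
      ring : ∀ H M → (2 + (H + H)) * M ≡ (1 + H) * M + (1 + H) * M
      ring = solve-∀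

  Sums-bounded : ∀ σ {h x} → Sums (Element σ) h x → x ≤ h * N
  Sums-bounded σ (l , al , refl , refl) = sum≤length*bound (All.map proj₂ al)

  1≤K : 1 ≤ K
  1≤K = >-nonZero⁻¹ K {{m*n≢0 (2 + (H + H)) M}}

  K≤N : K ≤ N
  K≤N = m≤m+n K K

  zero-element : ∀ σ → Element σ 0
  zero-element σ = inj₁ z≤n , z≤n

  one-element : ∀ σ → Element σ 1
  one-element σ = inj₁ ≤-refl , ≤-trans 1≤K K≤N

  Sums-initial : ∀ σ {h x} → x ≤ h → Sums (Element σ) h x
  Sums-initial σ {h} {x} x≤h = subst₂ (Sums (Element σ)) (m+[n∸m]≡n x≤h) (trans (+-identityʳ (x * 1)) (*-identityʳ x))
    (Sums-++ (Sums-replicate x (one-element σ)) (Sums-zero (zero-element σ) (h ∸ x)))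

  -- Induction on the number of terms: the split-off term is 0, K or N, chosen so that the remainder
  -- stays between K and the previous upper end.
  Sums-tail : ∀ σ h {x} → K ≤ x → x ≤ suc h * N → Sums (Element σ) (suc h) x
  Sums-tail σ zero {x} K≤x x≤ = Sums-1 (inj₂ (inj₁ K≤x) , subst (x ≤_) (+-identityʳ N) x≤)
  Sums-tail σ (suc h) {x} K≤x x≤ = case ≤-<-connex x (suc h * N) of λ where
      (inj₁ x≤′) → Sums-++ (Sums-1 (zero-element σ)) (Sums-tail σ h K≤x x≤′)
      (inj₂ N<x) → case ≤-<-connex x (suc h * N + K) of λ where
        (inj₁ x≤′) → remove K ≤-refl K≤N K≤x
          (+-cancelʳ-≤ K K (x ∸ K) (≤-trans (≤-trans (m≤m+n N (h * N)) (<⇒≤ N<x)) (≤-reflexive (sym (m∸n+n≡m K≤x)))))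
          (+-cancelʳ-≤ K (x ∸ K) (suc h * N) (≤-trans (≤-reflexive (m∸n+n≡m K≤x)) x≤′))
        (inj₂ N+K<x) → let N≤x = ≤-trans (≤-trans (m≤m+n N (h * N)) (m≤m+n (suc h * N) K)) (<⇒≤ N+K<x) in remove N K≤N ≤-refl N≤x
          (+-cancelʳ-≤ N K (x ∸ N) (≤-trans (≤-trans (≤-reflexive (+-comm K N)) (+-monoˡ-≤ K (m≤m+n N (h * N)))) (≤-trans (<⇒≤ N+K<x) (≤-reflexive (sym (m∸n+n≡m N≤x))))))
          (+-cancelʳ-≤ N (x ∸ N) (suc h * N) (≤-trans (≤-reflexive (m∸n+n≡m N≤x)) (≤-trans x≤ (≤-reflexive (+-comm N (suc h * N))))))
    where
    remove : ∀ a → K ≤ a → a ≤ N → a ≤ x → K ≤ x ∸ a → x ∸ a ≤ suc h * N → Sums (Element σ) (2 + h) x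
    remove a K≤a a≤N a≤x K≤ ≤hN = subst (Sums (Element σ) (2 + h)) (m+[n∸m]≡n a≤x)
      (Sums-++ (Sums-1 (inj₂ (inj₁ K≤a) , a≤N)) (Sums-tail σ h K≤ ≤hN))

  Sums-block : ∀ σ {h} i {y e} → y ∈ block σ i → e < h → Sums (Element σ) h (y + e)
  Sums-block σ {suc h} i {y} y∈ (s≤s e≤h) = Sums-++ (Sums-1 (inj₂ (inj₂ (i , y∈)) , y≤N)) (Sums-initial σ e≤h)
    where
    y≤N : y ≤ N
    y≤N with o , o∈ , refl ← ∈-block⁻ σ i y∈ =
      ≤-trans (<⇒≤ (origin+r<K i (subst (_< M) (+-identityʳ o) (offset+tail<M (rank≤H i) (offset≤ (σ i) (s≤s z≤n) o∈) (>-nonZero⁻¹ H))))) K≤N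

  middle∈ : ∀ σ i {s} → σ i ≡ s → origin i + middle s (rank i) ∈ block σ i
  middle∈ σ i refl = there (here refl)

  first∈ : ∀ σ i → origin i + 0 ∈ block σ i
  first∈ σ i = here refl

  last∈ : ∀ σ i → origin i + (rank i + rank i) ∈ block σ i
  last∈ σ i = there (there (here refl))

  -- Relative to the origin, the middle interval is [k, k + h) for `+` and [k + 1, k + 1 + h) for
  -- `-`. This is the end point that the interval for the given sign has and the other lacks.
  spot : ℕ → Sign → Fin H → ℕ
  spot h Sign.+ i = origin i + rank i
  spot h Sign.- i = origin i + (rank i + h)

  module Compare (σ τ : Fin H → Sign) (opposite-σ : ∀ i → τ i ≡ opposite (σ i)) (j : Fin H) (σj : σ j ≡ Sign.+) where

    h : ℕ
    h = rank j

    h≤H : h ≤ H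
    h≤H = rank≤H j

    -- The middle interval of block i in one sumset is that of the other moved by one,
    -- and for rank i ≤ h the two moved end points are covered by the outer intervals.
    Reach-swap : ∀ {x} → Reach τ h x → Reach σ h x ⊎ ∃[ i ] toℕ j < toℕ i × x ≡ spot h (τ i) i
    Reach-swap (inj₁ x≤h)        = inj₁ (inj₁ x≤h)
    Reach-swap (inj₂ (inj₁ K≤x)) = inj₁ (inj₂ (inj₁ K≤x))
    Reach-swap (inj₂ (inj₂ (i , _ , e , here refl , e<h , eq))) =
      inj₁ (inj₂ (inj₂ (i , _ , e , first∈ σ i , e<h , eq)))
    Reach-swap (inj₂ (inj₂ (i , _ , e , there (there (here refl)) , e<h , eq))) =
      inj₁ (inj₂ (inj₂ (i , _ , e , last∈ σ i , e<h , eq)))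
    Reach-swap (inj₂ (inj₂ (i , _ , e , there (here refl) , e<h , refl))) = shifted (σ i) refl (τ i) refl (opposite-σ i) e e<h
      where
      shifted : ∀ s → σ i ≡ s → ∀ t → τ i ≡ t → t ≡ opposite s → ∀ e → e < h →
        Reach σ h (origin i + middle t (rank i) + e) ⊎ ∃[ i′ ] toℕ j < toℕ i′ × origin i + middle t (rank i) + e ≡ spot h (τ i′) i′
      shifted Sign.+ σi .Sign.- τi refl e e<h with m≤n⇒m<n∨m≡n e<h
      ... | inj₁ 1+e<h = inj₁ (inj₂ (inj₂ (i , _ , suc e , middle∈ σ i σi , 1+e<h , ring (origin i) (rank i) e)))
        where
        ring : ∀ o k e → o + suc k + e ≡ o + k + suc e
        ring = solve-∀
      ... | inj₂ 1+e≡h with ≤-<-connex (rank i) h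
      ...   | inj₁ k≤h = inj₁ (inj₂ (inj₂ (i , _ , h ∸ rank i , last∈ σ i , ∸-monoʳ-< {h} z<s k≤h ,
                (begin
                  origin i + suc (rank i) + e                          ≡⟨ ring (origin i) (rank i) e ⟩
                  origin i + rank i + suc e                            ≡⟨ cong (λ l → origin i + rank i + l) (trans 1+e≡h (sym (m+[n∸m]≡n k≤h))) ⟩
                  origin i + rank i + (rank i + (h ∸ rank i))          ≡⟨ ring′ (origin i) (rank i) (h ∸ rank i) ⟩
                  origin i + (rank i + rank i) + (h ∸ rank i)          ∎))))
        where
        open ≡-Reasoning
        ring : ∀ o k e → o + suc k + e ≡ o + k + suc e
        ring = solve-∀
        ring′ : ∀ o k d → o + k + (k + d) ≡ o + (k + k) + d
        ring′ = solve-∀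
      ...   | inj₂ h<k = inj₂ (i , ≤-pred h<k , (begin
                  origin i + suc (rank i) + e    ≡⟨ ring (origin i) (rank i) e ⟩
                  origin i + (rank i + suc e)    ≡⟨ cong (λ l → origin i + (rank i + l)) 1+e≡h ⟩
                  origin i + (rank i + h)        ≡⟨ cong (λ s → spot h s i) τi ⟨
                  spot h (τ i) i                 ∎))
        where
        open ≡-Reasoning
        ring : ∀ o k e → o + suc k + e ≡ o + (k + suc e)
        ring = solve-∀
      shifted Sign.- σi .Sign.+ τi refl (suc e) e<h = inj₁ (inj₂ (inj₂ (i , _ , e , middle∈ σ i σi , <⇒≤ e<h , ring (origin i) (rank i) e)))
        where
        ring : ∀ o k e → o + k + suc e ≡ o + suc k + e
        ring = solve-∀
      shifted Sign.- σi .Sign.+ τi refl zero e<h with <-cmp (rank i) h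
      ... | tri< k<h _ _ = inj₁ (inj₂ (inj₂ (i , _ , rank i , first∈ σ i , k<h , ring (origin i) (rank i))))
        where
        ring : ∀ o k → o + k + 0 ≡ o + 0 + k
        ring = solve-∀
      -- For k = h the block is that of `j`, where σ has the sign `+`, contrary to the present case.
      ... | tri≈ _ k≡h _ with refl ← Fin.toℕ-injective (suc-injective k≡h) = case trans (sym σi) σj of λ ()
      ... | tri> _ _ h<k = inj₂ (i , ≤-pred h<k , trans (+-identityʳ _) (cong (λ s → spot h s i) (sym τi)))

    spot-reached : ∀ i → Reach σ h (spot h (σ i) i)
    spot-reached i = reached (σ i) refl
      where
      reached : ∀ s → σ i ≡ s → Reach σ h (spot h s i)
      reached Sign.+ σi = inj₂ (inj₂ (i , _ , 0 , middle∈ σ i σi , z<s , sym (+-identityʳ _)))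
      reached Sign.- σi = inj₂ (inj₂ (i , _ , toℕ j , middle∈ σ i σi , ≤-refl , ring (origin i) (rank i) (toℕ j)))
        where
        ring : ∀ o k e → o + (k + suc e) ≡ o + suc k + e
        ring = solve-∀

    residue : Sign → Fin H → ℕ
    residue Sign.+ i = rank i
    residue Sign.- i = rank i + h

    spot≡ : ∀ s i → spot h s i ≡ origin i + residue s i
    spot≡ Sign.+ i = refl
    spot≡ Sign.- i = refl

    residue<M : ∀ s i → residue s i < M
    residue<M s i = ≤-<-trans (bound s) (<-≤-trans (m<m+n (H + H) (>-nonZero⁻¹ H)) (≤-reflexive (ring H)))
      where
      bound : ∀ s → residue s i ≤ H + H
      bound Sign.+ = ≤-trans (rank≤H i) (m≤m+n H H)
      bound Sign.- = +-mono-≤ (rank≤H i) h≤H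
      ring : ∀ H → H + H + H ≡ 3 * H
      ring = solve-∀

    row-injective : ∀ {i i′} → row i ≡ row i′ → i ≡ i′
    row-injective eq = Fin.toℕ-injective (suc-injective (+-cancelˡ-≡ (1 + H) _ _ eq))

    spot-injective : ∀ s s′ {i i′} → spot h s i ≡ spot h s′ i′ → i ≡ i′
    spot-injective s s′ {i} {i′} eq = row-injective (proj₁ (quotient-remainder-unique M (row i) (row i′)
      (residue<M s i) (residue<M s′ i′) (trans (sym (spot≡ s i)) (trans eq (spot≡ s′ i′)))))

    h<[1+H]*M : h < (1 + H) * M
    h<[1+H]*M = <-≤-trans (s≤s h≤H) (m≤m*n (1 + H) M)

    -- Division by M shows that only block `i` itself could reach its spot; residues are then
    -- compared with its three intervals.
    spot-unreached : ∀ i → toℕ j ≤ toℕ i → ¬ Reach τ h (spot h (σ i) i)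
    spot-unreached i j≤i (inj₁ ≤h) = <⇒≱ h<[1+H]*M (≤-trans (origin-large i)
      (≤-trans (m≤m+n (origin i) _) (≤-trans (≤-reflexive (sym (spot≡ (σ i) i))) ≤h)))
    spot-unreached i j≤i (inj₂ (inj₁ K≤)) = <⇒≱ (origin+r<K i (residue<M (σ i) i)) (≤-trans K≤ (≤-reflexive (spot≡ (σ i) i)))
    spot-unreached i j≤i (inj₂ (inj₂ (i′ , y , e , y∈ , e<h , eq)))
      with o , o∈ , refl ← ∈-block⁻ τ i′ y∈
      with row≡ , r≡ ← quotient-remainder-unique M (row i) (row i′) (residue<M (σ i) i)
        (offset+tail<M (rank≤H i′) (offset≤ (τ i′) (s≤s z≤n) o∈) (<-≤-trans e<h h≤H))
        (trans (sym (spot≡ (σ i) i)) (trans eq (+-assoc (origin i′) o e)))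
      with refl ← row-injective row≡ = outside (σ i) refl (τ i) (opposite-σ i) o∈ r≡
      where
      k : ℕ
      k = rank i
      h≤k : h ≤ k
      h≤k = s≤s j≤i
      outside : ∀ s → σ i ≡ s → ∀ t → t ≡ opposite s → o ∈ offsets t k → residue s i ≡ o + e → ⊥
      outside Sign.+ _ .Sign.- refl (here refl) k≡ = <⇒≱ e<h (≤-trans h≤k (≤-reflexive k≡))
      outside Sign.+ _ .Sign.- refl (there (here refl)) k≡ = <⇒≢ (s≤s (m≤m+n k e)) k≡
      outside Sign.+ _ .Sign.- refl (there (there (here refl))) k≡ =
        <⇒≢ (<-≤-trans (m<m+n k z<s) (m≤m+n (k + k) e)) k≡
      outside Sign.- _ .Sign.+ refl (here refl) k≡ = <⇒≱ e<h (≤-trans (m≤n+m h k) (≤-reflexive k≡))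
      outside Sign.- _ .Sign.+ refl (there (here refl)) k≡ = <⇒≢ e<h (sym (+-cancelˡ-≡ k h e k≡))
      -- The last interval starts at 2 k and contains k + h only if k ≤ h. Then k = h, so the block
      -- is that of `j`, whose sign is `+`.
      outside Sign.- σi .Sign.+ refl (there (there (here refl))) k≡
        with refl ← Fin.toℕ-injective {i = j} {i} (≤-antisym j≤i (≤-pred (≤-trans (m≤m+n k e)
               (≤-reflexive (sym (+-cancelˡ-≡ k h (k + e) (trans k≡ (+-assoc k k e)))))))) =
        case trans (sym σi) σj of λ ()

    later : List (Fin H)
    later = filter (λ i → toℕ j <? toℕ i) (allFin H)

    ∈-later⁻ : ∀ {i} → i ∈ later → toℕ j < toℕ i
    ∈-later⁻ i∈ = proj₂ (∈-filter⁻ (λ i → toℕ j <? toℕ i) {xs = allFin H} i∈)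

    j∷later-! : Unique (j ∷ later)
    j∷later-! = All.tabulate (λ { i∈ refl → <-irrefl refl (∈-later⁻ i∈) })
      ∷ Unique.filter⁺ (λ i → toℕ j <? toℕ i) (Unique.allFin⁺ H)

    j≤ : ∀ {i} → i ∈ j ∷ later → toℕ j ≤ toℕ i
    j≤ (here refl) = ≤-refl
    j≤ (there i∈)  = <⇒≤ (∈-later⁻ i∈)

    ∈-hS⇒Reach : ∀ ρ {x} → + x ∈ sumset h (S ρ) → Reach ρ h x × x ≤ h * N
    ∈-hS⇒Reach ρ x∈ with _ , refl , s ← ∈-hS⁻ ρ h x∈ = Sums⇒Reach ρ s , Sums-bounded ρ s

    Reach⇒∈-hS : ∀ ρ {x} → Reach ρ h x → x ≤ h * N → + x ∈ sumset h (S ρ)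
    Reach⇒∈-hS ρ (inj₁ x≤h)        _  = ∈-hS⁺ ρ h (Sums-initial ρ x≤h)
    Reach⇒∈-hS ρ (inj₂ (inj₁ K≤x)) x≤ = ∈-hS⁺ ρ h (Sums-tail ρ (toℕ j) K≤x x≤)
    Reach⇒∈-hS ρ (inj₂ (inj₂ (i , y , e , y∈ , e<h , refl))) _ = ∈-hS⁺ ρ h (Sums-block ρ i y∈ e<h)

    spot≤hN : ∀ s i → spot h s i ≤ h * N
    spot≤hN s i = ≤-trans (≤-reflexive (spot≡ s i))
      (≤-trans (<⇒≤ (origin+r<K i (residue<M s i))) (≤-trans K≤N (m≤m+n N (toℕ j * N))))

    spots : (Fin H → Sign) → List (Fin H) → List ℤ
    spots ρ = map (λ i → + spot h (ρ i) i)

    -- Each block after `j` accounts for at most one point lost from τ to σ and for one gained,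
    -- earlier blocks for none lost. The block of `j` adds one further gain.
    smaller : ∣ sumset h (S τ) ∣ < ∣ sumset h (S σ) ∣
    smaller = +-cancelˡ-< (length later) _ _ (begin-strict
      length later + ∣ sumset h (S τ) ∣                      ≡⟨ +-comm (length later) _ ⟩
      ∣ sumset h (S τ) ∣ + length later                      <⟨ +-monoʳ-< ∣ sumset h (S τ) ∣ ≤-refl ⟩
      ∣ sumset h (S τ) ∣ + length (j ∷ later)                ≡⟨ cong (λ l → ∣ sumset h (S τ) ∣ + l) (length-map _ (j ∷ later)) ⟨
      ∣ sumset h (S τ) ∣ + length (spots σ (j ∷ later))      ≤⟨ exchanged ⟩
      length (spots τ later) + ∣ sumset h (S σ) ∣            ≡⟨ cong (_+ ∣ sumset h (S σ) ∣) (length-map _ later) ⟩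
      length later + ∣ sumset h (S σ) ∣                      ∎)
      where
      open ≤-Reasoning
      in-σ? : Decidable (_∈ sumset h (S σ))
      in-σ? z = z ∈? sumset h (S σ)
      exchanged : ∣ sumset h (S τ) ∣ + length (spots σ (j ∷ later)) ≤ length (spots τ later) + ∣ sumset h (S σ) ∣
      exchanged = length-exchange {P = _∉ sumset h (S σ)} (¬? ∘ in-σ?)
        (elements-! (sumset h (S τ)))
        (Unique.map⁺ (λ {i} {i′} eq → spot-injective (σ i) (σ i′) (ℤ.+-injective eq)) j∷later-!)
        (λ z∈ z∉ → lost (∈-elements⁻ z∈) z∉)
        (λ {z} _ ¬z∉ → ∈-elements⁺ (decidable-stable (in-σ? z) ¬z∉))
        (λ z∈ → case ∈-map⁻ _ z∈ of λ where
          (i , i∈ , refl) → ∈-elements⁺ (Reach⇒∈-hS σ (spot-reached i) (spot≤hN (σ i) i)) ,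
            λ z∈τ → contradiction (proj₁ (∈-hS⇒Reach τ (∈-elements⁻ z∈τ))) (spot-unreached i (j≤ i∈)))
        where
        lost : ∀ {z} → z ∈ sumset h (S τ) → z ∉ sumset h (S σ) → z ∈ spots τ later
        lost z∈ z∉ with x , refl , s ← ∈-hS⁻ τ h z∈ with Reach-swap (Sums⇒Reach τ s)
        ... | inj₁ r = contradiction (Reach⇒∈-hS σ r (Sums-bounded τ s)) z∉
        ... | inj₂ (i , j<i , refl) = ∈-map⁺ _ (∈-filter⁺ (λ i → toℕ j <? toℕ i) (∈-allFin i) j<i)

  -- The second set takes the opposite middle point in every block. A sign `-` becomes a sign `+`
  -- when the two sets are interchanged.
  realized : AllSignsRealizedIn[0, N ] H
  realized ε = S σ , S τ , S⊆ σ , S⊆ τ , λ i → signs i (lookup ε i) refl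
    where
    σ τ : Fin H → Sign
    σ = lookup ε
    τ = opposite ∘ σ
    signs : ∀ i s → σ i ≡ s → HasSign s (∣ sumset (rank i) (S σ) ∣ ⊖ ∣ sumset (rank i) (S τ) ∣)
    signs i Sign.+ σi = >⇒0<⊖ _ _ (Compare.smaller σ τ (λ _ → refl) i σi)
    signs i Sign.- σi = <⇒⊖<0 _ _ (Compare.smaller τ σ (λ i → sym (opposite-involutive (σ i))) i (cong opposite σi))
      where
      opposite-involutive : ∀ s → opposite (opposite s) ≡ s
      opposite-involutive Sign.+ = refl
      opposite-involutive Sign.- = refl

-- Here N equals 12 H + 12 H^2, and each of the two terms is at most 12 H^3.
N≤24*H^3 : ∀ H .{{_ : NonZero H}} → Construction.N H ≤ 24 * H ^ 3
N≤24*H^3 H = begin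
  Construction.N H                         ≡⟨ ring H ⟩
  12 * H + 12 * (H * H)                    ≤⟨ +-mono-≤ (*-monoʳ-≤ 12 (m≤m*n H (H * H))) (*-monoʳ-≤ 12 (*-monoʳ-≤ H (m≤m*n H H))) ⟩
  12 * (H * (H * H)) + 12 * (H * (H * H))  ≡⟨ ring′ H ⟩
  24 * H ^ 3                               ∎
  where
  open ≤-Reasoning
  instance
    H*H≢0 : NonZero (H * H)
    H*H≢0 = m*n≢0 H H
  ring : ∀ H → (2 + (H + H)) * (3 * H) + (2 + (H + H)) * (3 * H) ≡ 12 * H + 12 * (H * H)
  ring = solve-∀
  ring′ : ∀ H → 12 * (H * (H * H)) + 12 * (H * (H * H)) ≡ 24 * (H * (H * (H * 1)))
  ring′ = solve-∀

theorem1p7 : ∃[ C ] (C > 0) ×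
    ((H : ℕ) → H ≥ 3 →
    ∃[ N ] (ν[ H ]≡ N) × (H + 1 ≤ N) × (N ≤ C * H ^ 3))
theorem1p7 = 24 , z<s , λ H H≥3 → bounds H H≥3 {{>-nonZero (<-≤-trans z<s H≥3)}}
  where
  bounds : (H : ℕ) → H ≥ 3 → .{{NonZero H}} → ∃[ N ] (ν[ H ]≡ N) × (H + 1 ≤ N) × (N ≤ 24 * H ^ 3)
  bounds H H≥3 =
    let N , realizedN , minimal = least (all-signs-realized? H) (Construction.N H) (Construction.realized H) in
    N , (realizedN , minimal) ,
    subst (_≤ N) (+-comm 1 H) (realized⇒H<N H≥3 realizedN) ,
    ≤-trans (minimal (Construction.N H) (Construction.realized H)) (N≤24*H^3 H)
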